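{- Let $a,b,c,d \geq 0$ with $\{a,b\} \neq \{c,d\}$. Then the pattern sets $[1342,\sigma(0^{a+1}1^b)]$ and $[1342,\sigma(0^{c+1}1^d)]$ are not Wilf equivalent.
   Context: For a binary word $w=w_1\cdots w_{n-1}$, $\sigma(w)=\sigma_1\cdots\sigma_n$ is the permutation of $[n]$ where, for $k=1,\dots,n-1$, $\sigma_k$ is the minimum of the unused values of $[n]$ if $w_k=0$ and the maximum if $w_k=1$, and $\sigma_n$ is the remaining value. A circular permutation $[\pi]$ of size $n$ is the set of all rotations of a permutation $\pi$ of $[n]$; $[\sigma]$ contains $[\pi]$ if some rotation of $\sigma$ has a subsequence order-isomorphic to $\pi$, otherwise avoids it. $\mathrm{Av}_n[\pi_1,\dots,\pi_m]$ is the set of circular permutations of size $n$ avoiding each $[\pi_i]$; two pattern sets are Wilf equivalent if their $\mathrm{Av}_n$ have equal cardinality for every $n\ge 1$. -}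

module Defs where

open import Data.Nat using (ℕ; zero; suc; _+_; _∸_; _<ᵇ_; _≡ᵇ_; _≤_)
open import Data.Bool using (Bool; true; false; _∧_; _∨_; not; if_then_else_)
open import Data.List using (List; []; _∷_; _++_; length; map; concatMap; filter; replicate; zip)
open import Data.Bool.ListAction using (any; all)
open import Data.List.Relation.Unary.Any using (Any)
open import Data.Product using (_×_; _,_)
open import Relation.Binary.PropositionalEquality using (_≡_)
open import Relation.Nullary using (¬_)
open import Relation.Nullary.Decidable using (T?)
open import Data.Bool using (T)

-- Permutations of [n] are lists of the values 1..n in one-line notation.

insertions : ℕ → List ℕ → List (List ℕ)
insertions x [] = (x ∷ []) ∷ []
insertions x (y ∷ ys) = (x ∷ y ∷ ys) ∷ map (y ∷_) (insertions x ys)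

perms : ℕ → List (List ℕ)
perms zero = [] ∷ []
perms (suc n) = concatMap (insertions (suc n)) (perms n)

subseqs : List ℕ → List (List ℕ)
subseqs [] = [] ∷ []
subseqs (x ∷ xs) = map (x ∷_) (subseqs xs) ++ subseqs xs

rotate : List ℕ → List ℕ
rotate [] = []
rotate (x ∷ xs) = xs ++ (x ∷ [])

rotationsAux : ℕ → List ℕ → List (List ℕ)
rotationsAux zero l = []
rotationsAux (suc k) l = l ∷ rotationsAux k (rotate l)

rotations : List ℕ → List (List ℕ)
rotations l = rotationsAux (length l) l

sameLen : List ℕ → List ℕ → Bool
sameLen [] [] = true
sameLen (_ ∷ xs) (_ ∷ ys) = sameLen xs ys
sameLen _ _ = false

orderIso : List ℕ → List ℕ → Bool
orderIso s p = sameLen s p ∧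
  all (λ u → all (λ v → rel u v) sp) sp
  where
  sp = zip s p
  rel : ℕ × ℕ → ℕ × ℕ → Bool
  rel (a , b) (c , d) = (a <ᵇ c) ≡ᵇB (b <ᵇ d)
    where
    _≡ᵇB_ : Bool → Bool → Bool
    true ≡ᵇB true = true
    false ≡ᵇB false = true
    _ ≡ᵇB _ = false

containsLin : List ℕ → List ℕ → Bool
containsLin σ π = any (λ s → orderIso s π) (subseqs σ)

containsCirc : List ℕ → List ℕ → Bool
containsCirc σ π = any (λ r → containsLin r π) (rotations σ)

avoidsAll : List (List ℕ) → List ℕ → Bool
avoidsAll ps σ = all (λ π → not (containsCirc σ π)) ps

-- Circular permutations of size n: each rotation class [π] of permutations
-- of [n] (n ≥ 1) contains exactly one rotation starting with the value 1;
-- we use these as the canonical representatives of the classes.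
startsWith1 : List ℕ → Bool
startsWith1 (x ∷ _) = x ≡ᵇ 1
startsWith1 [] = false

circPerms : ℕ → List (List ℕ)
circPerms n = filter (λ π → T? (startsWith1 π)) (perms n)

avCount : List (List ℕ) → ℕ → ℕ
avCount ps n = length (filter (λ σ → T? (avoidsAll ps σ)) (circPerms n))

WilfEquivalent : List (List ℕ) → List (List ℕ) → Set
WilfEquivalent ps qs = ∀ n → 1 ≤ n → avCount ps n ≡ avCount qs n

-- σ(w) for a binary word w (false = 0, true = 1): values lo..hi still unused
sigmaAux : ℕ → ℕ → List Bool → List ℕ
sigmaAux lo hi [] = lo ∷ []
sigmaAux lo hi (false ∷ w) = lo ∷ sigmaAux (suc lo) hi w
sigmaAux lo hi (true ∷ w) = hi ∷ sigmaAux lo (hi ∸ 1) w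

sigma : List Bool → List ℕ
sigma w = sigmaAux 1 (suc (length w)) w

word : ℕ → ℕ → List Bool
word a b = replicate (suc a) false ++ replicate b true

p1342 : List ℕ
p1342 = 1 ∷ 3 ∷ 4 ∷ 2 ∷ []

{-# OPTIONS --safe #-}

-- The circular 1342-avoiders are the rotations of the lists σ(w), and σ(w), σ(w′) are rotations of
-- one another for w ≠ w′ only if {w , w′} = {0^{p+1}1^q , 1^{q+1}0^p}. Hence avoiders of
-- [1342, σ(0^{a+1}1^b)] of size m + 1 correspond to the words of length m, not of the form
-- 1^{q+1}0^p, without 0^{a+1}1^b or 1^{b+1}0^a as a subword. The number of words containing a
-- subword v depends only on |v|, so by inclusion-exclusion the counts determine a + b and, for each m,
-- the number of words containing both subwords; the shortest such word has length
-- a + b + 2 + min a b, so the counts determine min a b as well.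
module Submission where

open import Defs
open import Data.Nat using (ℕ; zero; suc; _+_; _<_; _>_; _≤_; _<ᵇ_; z≤n; s≤s; s≤s⁻¹)
open import Data.Nat.Properties
open import Data.Nat.Solver using (module +-*-Solver)
open import Algebra.Properties.CommutativeSemigroup +-commutativeSemigroup using (interchange)
open import Data.Bool using (Bool; true; false; not; T)
open import Data.Bool.Properties using (T-∧; T-≡)
import Data.Bool.Properties as Bool
open import Data.Bool.ListAction using (all)
open import Data.List using (List; []; _∷_; _++_; [_]; length; map; concatMap; filter; replicate;
  zip; applyDownFrom)
open import Data.List.Properties
  using (++-assoc; ++-identityʳ; length-++; length-replicate; ∷-injectiveˡ; ∷-injectiveʳ; ∷-injective; ≡-dec;
         filter-++; filter-all; filter-none; length-applyDownFrom)
open import Data.List.Membership.Propositional using (_∈_; _∉_; find; lose)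
open import Data.List.Membership.Propositional.Properties
  using (∈-++⁺ˡ; ∈-++⁺ʳ; ∈-++⁻; ∈-∃++; ∈-map⁺; ∈-map⁻; ∈-concatMap⁺; ∈-concatMap⁻; ∈-filter⁺; ∈-filter⁻)
open import Data.List.Relation.Unary.All using (All; []; _∷_)
import Data.List.Relation.Unary.All as All
import Data.List.Relation.Unary.All.Properties as All
open import Data.List.Relation.Unary.Any using (Any; here; there)
import Data.List.Relation.Unary.Any.Properties as Any
open import Data.List.Relation.Unary.AllPairs using (AllPairs; []; _∷_)
open import Data.List.Relation.Unary.Unique.Propositional using (Unique)
import Data.List.Relation.Unary.Unique.Propositional.Properties as Unique
open import Data.List.Relation.Binary.Sublist.Propositional
  using (_⊆_; []; _∷_; _∷ʳ_; ⊆-refl; minimum; from∈)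
open import Data.List.Relation.Binary.Sublist.Propositional.Properties using (All-resp-⊆; Any-resp-⊆)
open import Data.List.Relation.Binary.Sublist.Heterogeneous.Properties
  using (++⁺; ++ˡ; ++ʳ; ∷ʳ⁻; ∷⁻; length-mono-≤; ⊆-filter-Sublist)
open import Data.List.Relation.Binary.Sublist.DecPropositional Bool._≟_ using (_⊆?_)
open import Data.List.Relation.Binary.Permutation.Propositional
  using (_↭_; ↭⇒↭ₛ; ↭-refl; ↭-sym; ↭-trans; ↭-reflexive; prep; swap)
open import Data.List.Relation.Binary.Permutation.Propositional.Properties
  using (All-resp-↭; ∈-resp-↭; drop-∷; shift; ++-comm; ↭-length)
import Data.List.Relation.Binary.Permutation.Setoid.Properties as Perm
open import Data.Product using (_×_; _,_; proj₁; proj₂; ∃₂; ∃-syntax)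
open import Data.Sum using (_⊎_; inj₁; inj₂)
import Data.Sum as Sum
open import Data.Empty using (⊥-elim)
open import Data.Unit using (tt)
open import Function using (_∘_; id; Equivalence)
open import Relation.Binary using (tri<; tri≈; tri>)
import Relation.Binary as B
open import Relation.Binary.PropositionalEquality
  using (_≡_; _≢_; refl; sym; trans; cong; cong₂; subst; subst₂; setoid; module ≡-Reasoning)
open import Relation.Nullary using (¬_; yes; no; contradiction)
open import Relation.Nullary.Decidable using (T?; map′; ¬?; _×-dec_; _⊎-dec_)
open import Relation.Unary using (Decidable)

-- The words 1^{q+1}0^p are the obstacle to inclusion-exclusion: it works on all words of a given
-- length, whereas the avoiders count only the words outside this family. What has to be supplied is
-- the number of excluded words that contain one of the two subwords. These are the words
-- 1^{b+t+1}0^{a+s}, so for each length their number depends on a + b alone. Hence a + b must be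
-- recovered before the words containing both subwords can be compared, and this cannot rest on
-- inclusion-exclusion. It rests on the word 0^{a+1}1^b itself, which begins with 0, is therefore
-- not excluded, and has the least length at which the pattern can occur.
--
-- `Code` speaks of arbitrary lists of numbers, not of permutations of an interval, so sublists and
-- rotated blocks are coded without first being standardised.

private variable
  A C : Set
  w w′ v : List Bool
  x y : ℕ
  xs ys zs s t : List ℕ

-- Lists all of whose entries are extremal in the remaining suffix

-- Code w xs: xs is order-isomorphic to σ(w).
data Code : List Bool → List ℕ → Set where
  last : Code [] [ x ]
  low  : All (x <_) xs → Code w xs → Code (false ∷ w) (x ∷ xs)
  high : All (_< x) xs → Code w xs → Code (true ∷ w) (x ∷ xs)

Code-length : Code w xs → length xs ≡ suc (length w)
Code-length last       = refl
Code-length (low _ c)  = cong suc (Code-length c)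
Code-length (high _ c) = cong suc (Code-length c)

¬below-and-above : All (x <_) xs → All (_< x) xs → ¬ Code w xs
¬below-and-above (p ∷ _) (q ∷ _) _ = <-asym p q

Code-functional : Code w xs → Code w′ xs → w ≡ w′
Code-functional last last = refl
Code-functional (low _ c)  (low _ c′)  = cong (false ∷_) (Code-functional c c′)
Code-functional (high _ c) (high _ c′) = cong (true ∷_) (Code-functional c c′)
Code-functional (low l c)  (high h _)  = ⊥-elim (¬below-and-above l h c)
Code-functional (high h c) (low l _)   = ⊥-elim (¬below-and-above l h c)

Code-injective-↭ : Code w xs → Code w ys → xs ↭ ys → xs ≡ ys
Code-injective-↭ last last p with ∈-resp-↭ p (here refl)
... | here refl = refl
Code-injective-↭ (low {x = x} l c) (low {x = y} l′ c′) p
  with ∈-resp-↭ p (here refl) | ∈-resp-↭ (↭-sym p) (here refl)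
... | here refl | _         = cong (x ∷_) (Code-injective-↭ c c′ (drop-∷ p))
... | _         | here refl = cong (x ∷_) (Code-injective-↭ c c′ (drop-∷ p))
... | there i   | there j   = ⊥-elim (<-asym (All.lookup l′ i) (All.lookup l j))
Code-injective-↭ (high {x = x} h c) (high {x = y} h′ c′) p
  with ∈-resp-↭ p (here refl) | ∈-resp-↭ (↭-sym p) (here refl)
... | here refl | _         = cong (x ∷_) (Code-injective-↭ c c′ (drop-∷ p))
... | _         | here refl = cong (x ∷_) (Code-injective-↭ c c′ (drop-∷ p))
... | there i   | there j   = ⊥-elim (<-asym (All.lookup h′ i) (All.lookup h j))

Code-⊆⁻ : Code w xs → (x ∷ s) ⊆ xs → ∃[ v ] v ⊆ w × Code v (x ∷ s)
Code-⊆⁻ last (refl ∷ []) = [] , [] , last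
Code-⊆⁻ (low _ c) (_ ∷ʳ p) with v , q , d ← Code-⊆⁻ c p = v , _ ∷ʳ q , d
Code-⊆⁻ (high _ c) (_ ∷ʳ p) with v , q , d ← Code-⊆⁻ c p = v , _ ∷ʳ q , d
-- The final entry of a coded list carries no letter, so when `x` becomes final its letter is
-- dropped.
Code-⊆⁻ {s = []} (low _ _) (_ ∷ _) = [] , minimum _ , last
Code-⊆⁻ {s = []} (high _ _) (_ ∷ _) = [] , minimum _ , last
Code-⊆⁻ {s = _ ∷ _} (low l c) (refl ∷ p) with v , q , d ← Code-⊆⁻ c p =
  false ∷ v , refl ∷ q , low (All-resp-⊆ p l) d
Code-⊆⁻ {s = _ ∷ _} (high h c) (refl ∷ p) with v , q , d ← Code-⊆⁻ c p =
  true ∷ v , refl ∷ q , high (All-resp-⊆ p h) d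

-- The entries belonging to the letters of `v` are kept, and always the final entry of `xs`, which
-- has no letter.
Code-⊆⁺ : Code w xs → v ⊆ w → ∃[ s ] s ⊆ xs × Code v s
Code-⊆⁺ last [] = _ , ⊆-refl , last
Code-⊆⁺ (low _ c) (_ ∷ʳ p) with s , q , d ← Code-⊆⁺ c p = s , _ ∷ʳ q , d
Code-⊆⁺ (high _ c) (_ ∷ʳ p) with s , q , d ← Code-⊆⁺ c p = s , _ ∷ʳ q , d
Code-⊆⁺ (low l c) (refl ∷ p) with s , q , d ← Code-⊆⁺ c p =
  _ ∷ s , refl ∷ q , low (All-resp-⊆ q l) d
Code-⊆⁺ (high h c) (refl ∷ p) with s , q , d ← Code-⊆⁺ c p =
  _ ∷ s , refl ∷ q , high (All-resp-⊆ q h) d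

-- Order isomorphism

Concordant : ℕ × ℕ → ℕ × ℕ → Set
Concordant (a , b) (c , d) = (a < c × b < d) ⊎ (c < a × d < b)

infix 4 _≅_
record _≅_ (s t : List ℕ) : Set where
  field
    same-length : T (sameLen s t)
    same-order  : ∀ {a b c d} → (a , b) ∈ zip s t → (c , d) ∈ zip s t → (a <ᵇ c) ≡ (b <ᵇ d)
open _≅_

<⇒<ᵇ≡true : x < y → (x <ᵇ y) ≡ true
<⇒<ᵇ≡true = Equivalence.to T-≡ ∘ <⇒<ᵇ

≮⇒<ᵇ≡false : ¬ x < y → (x <ᵇ y) ≡ false
≮⇒<ᵇ≡false {x} {y} x≮y with x <ᵇ y in eq
... | false = refl
... | true  = contradiction (<ᵇ⇒< x y (Equivalence.from T-≡ eq)) x≮y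

Concordant⇒same-order : ∀ {a b c d} → Concordant (a , b) (c , d) →
  (a <ᵇ c) ≡ (b <ᵇ d) × (c <ᵇ a) ≡ (d <ᵇ b)
Concordant⇒same-order (inj₁ (p , q)) =
  trans (<⇒<ᵇ≡true p) (sym (<⇒<ᵇ≡true q)) , trans (≮⇒<ᵇ≡false (<-asym p)) (sym (≮⇒<ᵇ≡false (<-asym q)))
Concordant⇒same-order (inj₂ (p , q)) =
  trans (≮⇒<ᵇ≡false (<-asym p)) (sym (≮⇒<ᵇ≡false (<-asym q))) , trans (<⇒<ᵇ≡true p) (sym (<⇒<ᵇ≡true q))

concordant⇒≅ : T (sameLen s t) → AllPairs Concordant (zip s t) → s ≅ t
concordant⇒≅ {s} {t} len ps = record { same-length = len ; same-order = agree ps }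
  where
  agree : ∀ {ps a b c d} → AllPairs Concordant ps → (a , b) ∈ ps → (c , d) ∈ ps → (a <ᵇ c) ≡ (b <ᵇ d)
  agree {a = a} {b} _ (here refl) (here refl) = trans (≮⇒<ᵇ≡false (n≮n a)) (sym (≮⇒<ᵇ≡false (n≮n b)))
  agree (p ∷ _)  (here refl) (there j)   = proj₁ (Concordant⇒same-order (All.lookup p j))
  agree (p ∷ _)  (there i)   (here refl) = proj₂ (Concordant⇒same-order (All.lookup p i))
  agree (_ ∷ ps) (there i)   (there j)   = agree ps i j

orderIso⇒≅ : ∀ s t → T (orderIso s t) → s ≅ t
orderIso⇒≅ s t h with len , h′ ← Equivalence.to (T-∧ {sameLen s t}) h =
  record { same-length = len ; same-order = agree }
  where
  agree : ∀ {a b c d} → (a , b) ∈ zip s t → (c , d) ∈ zip s t → (a <ᵇ c) ≡ (b <ᵇ d)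
  agree {a} {b} {c} {d} i j
    with a <ᵇ c | b <ᵇ d | All.lookup (All.all⁺ _ _ (All.lookup (All.all⁺ _ _ h′) i)) j
  ... | true  | true  | _ = refl
  ... | false | false | _ = refl

all-all-counterexample : {r : A → A → Bool} (xs ys : List A) → ¬ T (all (λ u → all (r u) ys) xs) →
  ∃₂ λ u v → u ∈ xs × v ∈ ys × ¬ T (r u v)
all-all-counterexample {r = r} xs ys ¬p
  with u , i , ¬q ← find (All.¬All⇒Any¬ (λ u → T? (all (r u) ys)) xs (¬p ∘ All.all⁻ _))
  with v , j , ¬r ← find (All.¬All⇒Any¬ (λ v → T? (r u v)) ys (¬q ∘ All.all⁻ _))
  = u , v , i , j , ¬r

-- The comparison used by orderIso is local to its definition and cannot be named here,
-- so this direction refutes a counterexample instead of building the conjunction.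
≅⇒orderIso : s ≅ t → T (orderIso s t)
≅⇒orderIso {s} {t} iso with T? (orderIso s t)
... | yes p = p
... | no ¬p with (a , b) , (c , d) , i , j , ¬r ←
      all-all-counterexample (zip s t) (zip s t) (λ h → ¬p (Equivalence.from (T-∧ {sameLen s t}) (same-length iso , h)))
    with a <ᵇ c | b <ᵇ d | same-order iso i j
... | true  | true  | _ = ⊥-elim (¬r tt)
... | false | false | _ = ⊥-elim (¬r tt)

≅-tail : (x ∷ s) ≅ (y ∷ t) → s ≅ t
≅-tail iso = record
  { same-length = same-length iso ; same-order = λ i j → same-order iso (there i) (there j) }

zip-partner : ∀ s t → T (sameLen s t) → x ∈ s → ∃[ y ] y ∈ t × (x , y) ∈ zip s t
zip-partner (_ ∷ s) (y ∷ t) len (here refl) = y , here refl , here refl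
zip-partner (_ ∷ s) (_ ∷ t) len (there i) with y , j , k ← zip-partner s t len i = y , there j , there k

-- Being below or above the whole remaining suffix depends only on relative order.
≅-Code : s ≅ t → Code v t → Code v s
≅-Code {x ∷ []} iso last = last
≅-Code {[]} iso last with () ← same-length iso
≅-Code {_ ∷ _ ∷ _} iso last with () ← same-length iso
≅-Code {[]} iso (low _ _) with () ← same-length iso
≅-Code {[]} iso (high _ _) with () ← same-length iso
≅-Code {x ∷ s} {y ∷ t} iso (low l c) = low (All.tabulate below) (≅-Code (≅-tail iso) c)
  where
  below : ∀ {z} → z ∈ s → x < z
  below {z} i with d , j , k ← zip-partner s t (same-length iso) i =
    <ᵇ⇒< x z (subst T (sym (same-order iso (here refl) (there k))) (<⇒<ᵇ (All.lookup l j)))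
≅-Code {x ∷ s} {y ∷ t} iso (high h c) = high (All.tabulate above) (≅-Code (≅-tail iso) c)
  where
  above : ∀ {z} → z ∈ s → z < x
  above {z} i with d , j , k ← zip-partner s t (same-length iso) i =
    <ᵇ⇒< z x (subst T (sym (same-order iso (there k) (here refl))) (<⇒<ᵇ (All.lookup h j)))

All-zip : ∀ {P Q : ℕ → Set} → All P s → All Q t → All (λ (a , b) → P a × Q b) (zip s t)
All-zip []       _        = []
All-zip (_ ∷ _)  []       = []
All-zip (p ∷ ps) (q ∷ qs) = (p , q) ∷ All-zip ps qs

Code-zip : Code v s → Code v t → T (sameLen s t) × AllPairs Concordant (zip s t)
Code-zip last last = tt , [] ∷ []
Code-zip (low l c) (low l′ c′) with len , ps ← Code-zip c c′ = len , All.map inj₁ (All-zip l l′) ∷ ps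
Code-zip (high h c) (high h′ c′) with len , ps ← Code-zip c c′ = len , All.map inj₂ (All-zip h h′) ∷ ps

Code⇒≅ : Code v s → Code v t → s ≅ t
Code⇒≅ c c′ = let len , ps = Code-zip c c′ in concordant⇒≅ len ps

-- Rotations and circular containment

infix 4 _↻_
-- A rotation is a swap of two blocks, possibly empty, because a cut of a list restricts to its
-- sublists and a cut of a sublist extends to the list.
_↻_ : List A → List A → Set
xs ↻ ys = ∃₂ λ p q → xs ≡ p ++ q × ys ≡ q ++ p

module _ {A : Set} where
  private variable as bs cs : List A

  -- Levi's lemma; `u` is the overlap of the two cuts.
  ++-split : ∀ (p : List A) {q} p′ {q′} → p ++ q ≡ p′ ++ q′ →
    (∃[ u ] p ≡ p′ ++ u × q′ ≡ u ++ q) ⊎ (∃[ u ] p′ ≡ p ++ u × q ≡ u ++ q′)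
  ++-split []      p′       eq = inj₂ (p′ , refl , eq)
  ++-split (x ∷ p) []       eq = inj₁ (x ∷ p , refl , sym eq)
  ++-split (x ∷ p) (y ∷ p′) eq with refl , eq′ ← ∷-injective eq with ++-split p p′ eq′
  ... | inj₁ (u , refl , e) = inj₁ (u , refl , e)
  ... | inj₂ (u , refl , e) = inj₂ (u , refl , e)

  ↻-refl : as ↻ as
  ↻-refl {as} = [] , as , refl , sym (++-identityʳ as)

  ↻-sym : as ↻ bs → bs ↻ as
  ↻-sym (p , q , e , e′) = q , p , e′ , e

  ↻-trans : as ↻ bs → bs ↻ cs → as ↻ cs
  ↻-trans (p , q , refl , refl) (p′ , q′ , e , refl) with ++-split q p′ e
  ... | inj₁ (u , refl , refl) = p ++ p′ , u , sym (++-assoc p p′ u) , ++-assoc u p p′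
  ... | inj₂ (u , refl , refl) = u , q′ ++ q , ++-assoc u q′ q , sym (++-assoc q′ q u)

  ↻⇒↭ : as ↻ bs → as ↭ bs
  ↻⇒↭ (p , q , refl , refl) = ++-comm p q

  ⊆-++⁻ : ∀ p → as ⊆ p ++ bs → ∃₂ λ q r → as ≡ q ++ r × q ⊆ p × r ⊆ bs
  ⊆-++⁻ []      h = [] , _ , refl , [] , h
  ⊆-++⁻ (x ∷ p) (_ ∷ʳ h) with q , r , e , i , j ← ⊆-++⁻ p h = q , r , e , x ∷ʳ i , j
  ⊆-++⁻ (x ∷ p) (refl ∷ h) with q , r , refl , i , j ← ⊆-++⁻ p h = x ∷ q , r , refl , refl ∷ i , j

  ++-⊆⁻ : ∀ p → p ++ as ⊆ bs → ∃₂ λ q r → bs ≡ q ++ r × p ⊆ q × as ⊆ r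
  ++-⊆⁻ []      h = [] , _ , refl , [] , h
  ++-⊆⁻ (x ∷ p) (y ∷ʳ h) with q , r , refl , i , j ← ++-⊆⁻ (x ∷ p) h = y ∷ q , r , refl , y ∷ʳ i , j
  ++-⊆⁻ (x ∷ p) (refl ∷ h) with q , r , refl , i , j ← ++-⊆⁻ p h = x ∷ q , r , refl , refl ∷ i , j

  ⊆-rotate-whole : as ⊆ bs → bs ↻ cs → ∃[ ds ] as ↻ ds × ds ⊆ cs
  ⊆-rotate-whole h (p , q , refl , refl) with u , v , refl , i , j ← ⊆-++⁻ p h =
    v ++ u , (u , v , refl , refl) , ++⁺ j i

  ⊆-rotate-part : as ⊆ bs → as ↻ cs → ∃[ ds ] bs ↻ ds × cs ⊆ ds
  ⊆-rotate-part h (p , q , refl , refl) with u , v , refl , i , j ← ++-⊆⁻ p h =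
    v ++ u , (u , v , refl , refl) , ++⁺ j i


↻⇒∈rotationsAux : ∀ k p {q} → length p < k → q ++ p ∈ rotationsAux k (p ++ q)
↻⇒∈rotationsAux (suc k) [] {q} _ = here (++-identityʳ q)
↻⇒∈rotationsAux (suc k) (x ∷ p) {q} (s≤s h) =
  there (subst₂ (λ l r → l ∈ rotationsAux k r) (++-assoc q [ x ] p) (sym (++-assoc p q [ x ]))
    (↻⇒∈rotationsAux k p h))

↻⇒∈rotations : (x ∷ xs) ↻ ys → ys ∈ rotations (x ∷ xs)
-- The cut after the last entry lies beyond the enumerated ones, but it gives the list itself, which
-- is enumerated first.
↻⇒∈rotations {x} {xs} (p , [] , e , refl) = here (sym (trans e (++-identityʳ p)))
↻⇒∈rotations (p , y ∷ q , e , refl) = subst (λ l → y ∷ q ++ p ∈ rotations l) (sym e)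
  (↻⇒∈rotationsAux _ p (subst (length p <_) (sym (length-++ p)) (m<m+n (length p) (s≤s z≤n))))

rotate-↻ : ∀ xs → xs ↻ rotate xs
rotate-↻ []       = ↻-refl
rotate-↻ (x ∷ xs) = [ x ] , xs , refl , refl

∈rotationsAux⇒↻ : ∀ k xs → ys ∈ rotationsAux k xs → xs ↻ ys
∈rotationsAux⇒↻ (suc k) xs (here refl) = ↻-refl
∈rotationsAux⇒↻ (suc k) xs (there i)   = ↻-trans (rotate-↻ xs) (∈rotationsAux⇒↻ k (rotate xs) i)

⊆⇒∈subseqs : s ⊆ xs → s ∈ subseqs xs
⊆⇒∈subseqs [] = here refl
⊆⇒∈subseqs {xs = x ∷ xs} (_ ∷ʳ h) = ∈-++⁺ʳ (map (x ∷_) (subseqs xs)) (⊆⇒∈subseqs h)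
⊆⇒∈subseqs (refl ∷ h) = ∈-++⁺ˡ (∈-map⁺ _ (⊆⇒∈subseqs h))

∈subseqs⇒⊆ : ∀ xs → s ∈ subseqs xs → s ⊆ xs
∈subseqs⇒⊆ [] (here refl) = []
∈subseqs⇒⊆ (x ∷ xs) i with ∈-++⁻ (map (x ∷_) (subseqs xs)) i
... | inj₁ j with _ , k , refl ← ∈-map⁻ _ j = refl ∷ ∈subseqs⇒⊆ xs k
... | inj₂ k = x ∷ʳ ∈subseqs⇒⊆ xs k

Contains : List ℕ → List ℕ → Set
Contains σ π = ∃₂ λ r s → σ ↻ r × s ⊆ r × s ≅ π

Contains⇒containsCirc : ∀ {π} → Contains (x ∷ xs) π → T (containsCirc (x ∷ xs) π)
Contains⇒containsCirc {π = π} (r , s , rot , sub , iso) =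
  Any.any⁺ _ (lose (↻⇒∈rotations rot) (Any.any⁺ _ (lose (⊆⇒∈subseqs sub) (≅⇒orderIso iso))))

containsCirc⇒Contains : ∀ σ π → T (containsCirc σ π) → Contains σ π
containsCirc⇒Contains σ π h
  with r , i , h′ ← find (Any.any⁻ _ (rotations σ) h)
  with s , j , iso ← find (Any.any⁻ _ (subseqs r) h′) =
  r , s , ∈rotationsAux⇒↻ _ σ i , ∈subseqs⇒⊆ r j , orderIso⇒≅ s π iso

-- Rotations of coded lists

-- The list σ(0^{a+1}1^b) rises through `a + 1` entries and then falls through `b + 1`. Started at
-- its maximum, it falls through `b + 1` entries and then rises through `a + 1`, the last of which
-- has no letter: this is 1^{b+1}0^a.
dual : ℕ → ℕ → List Bool
dual a b = replicate (suc b) true ++ replicate a false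

Flip : List Bool → List Bool → Set
Flip w w′ = ∃₂ λ a b → w ≡ word a b × w′ ≡ dual a b

¬Code-[] : ∀ s → ¬ Code [] (x ∷ s ++ y ∷ t)
¬Code-[] []      ()
¬Code-[] (_ ∷ _) ()

-- Every entry of `s` has the larger entry `x` behind it and so cannot be the maximum of its suffix.
low-prefix⁻ : ∀ s → All (_< x) s → Code w (s ++ x ∷ t) →
  ∃[ v ] w ≡ replicate (length s) false ++ v × Code v (x ∷ t)
low-prefix⁻ []      _       c = _ , refl , c
low-prefix⁻ {w = []} (y ∷ s) _ c = ⊥-elim (¬Code-[] s c)
low-prefix⁻ (y ∷ s) (p ∷ ps) (low _ c) with v , refl , d ← low-prefix⁻ s ps c = v , refl , d
low-prefix⁻ (y ∷ s) (p ∷ ps) (high h _) = ⊥-elim (<-asym p (All.lookup h (∈-++⁺ʳ s (here refl))))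

high-prefix⁻ : ∀ s → All (x <_) s → Code w (s ++ x ∷ t) →
  ∃[ v ] w ≡ replicate (length s) true ++ v × Code v (x ∷ t)
high-prefix⁻ []      _       c = _ , refl , c
high-prefix⁻ {w = []} (y ∷ s) _ c = ⊥-elim (¬Code-[] s c)
high-prefix⁻ (y ∷ s) (p ∷ ps) (high _ c) with v , refl , d ← high-prefix⁻ s ps c = v , refl , d
high-prefix⁻ (y ∷ s) (p ∷ ps) (low l _) = ⊥-elim (<-asym p (All.lookup l (∈-++⁺ʳ s (here refl))))

low-prefix-Code : ∀ s → All (_< x) (y ∷ s) → Code w (y ∷ s ++ x ∷ t) → Code (replicate (length s) false) (y ∷ s)
low-prefix-Code []      _        _          = last
low-prefix-Code (z ∷ s) (_ ∷ ps) (low l c)  = low (All.++⁻ˡ (z ∷ s) l) (low-prefix-Code s ps c)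
low-prefix-Code (z ∷ s) (p ∷ _)  (high h _) = ⊥-elim (<-asym p (All.lookup h (∈-++⁺ʳ (z ∷ s) (here refl))))

high-prefix-Code : ∀ s → All (x <_) (y ∷ s) → Code w (y ∷ s ++ x ∷ t) → Code (replicate (length s) true) (y ∷ s)
high-prefix-Code []      _        _          = last
high-prefix-Code (z ∷ s) (_ ∷ ps) (high h c) = high (All.++⁻ˡ (z ∷ s) h) (high-prefix-Code s ps c)
high-prefix-Code (z ∷ s) (p ∷ _)  (low l _)  = ⊥-elim (<-asym p (All.lookup l (∈-++⁺ʳ (z ∷ s) (here refl))))

private
  -- If x is minimal and y maximal, every entry between x and y in x ∷ s ++ y ∷ t is below y and
  -- hence a minimum of its suffix, and in y ∷ t ++ x ∷ s every entry between y and x a maximum.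
  rotated-Codes : ∀ s t → All (x <_) (y ∷ t) → All (_< y) (x ∷ s) →
    Code w (x ∷ s ++ y ∷ t) → Code w′ (y ∷ t ++ x ∷ s) → Flip w w′
  rotated-Codes {x} {y} s t l h c c′
    with v , refl , d ← low-prefix⁻ (x ∷ s) h c
    with v′ , refl , d′ ← high-prefix⁻ (y ∷ t) l c′ =
    length s , length t ,
    cong (replicate (suc (length s)) false ++_) (Code-functional d (high-prefix-Code t l c′)) ,
    cong (replicate (suc (length t)) true ++_) (Code-functional d′ (low-prefix-Code s h c))

-- In a proper rotation the heads `x` and `y` of the blocks open the two lists, so both are extremal
-- among all entries. They cannot both be minimal or both maximal; if one is the minimum and the
-- other the maximum, `rotated-Codes` applies.
Code-↻ : Code w xs → Code w′ ys → xs ↻ ys → w ≡ w′ ⊎ Flip w w′ ⊎ Flip w′ w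
Code-↻ c c′ ([] , t , refl , refl) =
  inj₁ (Code-functional c (subst (Code _) (++-identityʳ t) c′))
Code-↻ c c′ (x ∷ s , [] , refl , refl) =
  inj₁ (Code-functional (subst (Code _) (++-identityʳ (x ∷ s)) c) c′)
Code-↻ {w = []} c _ (x ∷ s , y ∷ t , refl , refl) = ⊥-elim (¬Code-[] s c)
Code-↻ {w′ = []} _ c′ (x ∷ s , y ∷ t , refl , refl) = ⊥-elim (¬Code-[] t c′)
Code-↻ c@(low l _) c′@(high h _) (x ∷ s , y ∷ t , refl , refl) =
  inj₂ (inj₁ (rotated-Codes s t (All.++⁻ʳ s l) (All.++⁻ʳ t h) c c′))
Code-↻ c@(high h _) c′@(low l _) (x ∷ s , y ∷ t , refl , refl) =
  inj₂ (inj₂ (rotated-Codes t s (All.++⁻ʳ t l) (All.++⁻ʳ s h) c′ c))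
Code-↻ (low l _) (low l′ _) (x ∷ s , y ∷ t , refl , refl) =
  ⊥-elim (<-asym (All.lookup l (∈-++⁺ʳ s (here refl))) (All.lookup l′ (∈-++⁺ʳ t (here refl))))
Code-↻ (high h _) (high h′ _) (x ∷ s , y ∷ t , refl , refl) =
  ⊥-elim (<-asym (All.lookup h (∈-++⁺ʳ s (here refl))) (All.lookup h′ (∈-++⁺ʳ t (here refl))))

low-prefix⁺ : AllPairs _<_ s → All (λ y → All (y <_) xs) s → Code w xs →
  Code (replicate (length s) false ++ w) (s ++ xs)
low-prefix⁺ []       _        c = c
low-prefix⁺ (p ∷ ps) (q ∷ qs) c = low (All.++⁺ p q) (low-prefix⁺ ps qs c)

high-prefix⁺ : AllPairs _>_ s → All (λ y → All (_< y) xs) s → Code w xs →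
  Code (replicate (length s) true ++ w) (s ++ xs)
high-prefix⁺ []       _        c = c
high-prefix⁺ (p ∷ ps) (q ∷ qs) c = high (All.++⁺ p q) (high-prefix⁺ ps qs c)

descending-Code : AllPairs _>_ (x ∷ s) → Code (replicate (length s) true) (x ∷ s)
descending-Code {s = []}    _        = last
descending-Code {s = _ ∷ _} (p ∷ ps) = high p (descending-Code ps)

ascending-Code⁻ : ∀ k → Code (replicate k false) xs → AllPairs _<_ xs
ascending-Code⁻ zero    last      = [] ∷ []
ascending-Code⁻ (suc k) (low l c) = l ∷ ascending-Code⁻ k c

high-split : ∀ k → Code (replicate k true ++ w) xs → ∃₂ λ s t →
  xs ≡ s ++ t × length s ≡ k × AllPairs _>_ s × All (λ x → All (x <_) s) t × Code w t
high-split zero    c = [] , _ , refl , refl , [] , All.tabulate (λ _ → []) , c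
high-split (suc k) (high h c) with s , t , refl , refl , d , b , c′ ← high-split k c =
  _ ∷ s , t , refl , refl , All.++⁻ˡ s h ∷ d , All.zipWith (λ (p , q) → p ∷ q) (All.++⁻ʳ s h , b) , c′

-- The falling block is moved behind the rising one. The block at the end has one letter fewer than
-- entries, so the zeros gain a letter and the ones lose one.
dual-↻-word : ∀ a b → Code (dual a b) xs → ∃[ ys ] xs ↻ ys × Code (word a b) ys
dual-↻-word a b c with high-split (suc b) c
... | x ∷ s , t , refl , refl , d , b , c′ = t ++ x ∷ s , (x ∷ s , t , refl , refl) ,
  subst (λ k → Code (replicate k false ++ replicate (length s) true) (t ++ x ∷ s))
    (trans (Code-length c′) (cong suc (length-replicate a)))
    (low-prefix⁺ (ascending-Code⁻ a c′) b (descending-Code d))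

-- Circular avoiders of 1342 are the rotations of coded lists

AllPairs-resp-⊆ : ∀ {R : A → A → Set} {as bs} → as ⊆ bs → AllPairs R bs → AllPairs R as
AllPairs-resp-⊆ []         ps       = ps
AllPairs-resp-⊆ (_ ∷ʳ h)   (_ ∷ ps) = AllPairs-resp-⊆ h ps
AllPairs-resp-⊆ (refl ∷ h) (p ∷ ps) = All-resp-⊆ h p ∷ AllPairs-resp-⊆ h ps

allPairs-or-counterexample : ∀ {R : A → A → Set} → B.Decidable R → ∀ as →
  AllPairs R as ⊎ ∃₂ λ a b → a ∷ b ∷ [] ⊆ as × ¬ R a b
allPairs-or-counterexample R? [] = inj₁ []
allPairs-or-counterexample R? (a ∷ as) with allPairs-or-counterexample R? as
... | inj₂ (b , c , h , ¬r) = inj₂ (b , c , a ∷ʳ h , ¬r)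
... | inj₁ ps with All.all? (R? a) as
...   | yes p = inj₁ (p ∷ ps)
...   | no ¬p with b , i , ¬r ← find (All.¬All⇒Any¬ (R? a) as ¬p) = inj₂ (a , b , refl ∷ from∈ i , ¬r)

pair-⊆ : ∀ {a b : A} {as} → a ∈ as → b ∈ as → a ≢ b → a ∷ b ∷ [] ⊆ as ⊎ b ∷ a ∷ [] ⊆ as
pair-⊆ (here refl) (here refl) a≢b = contradiction refl a≢b
pair-⊆ (here refl) (there j)   _   = inj₁ (refl ∷ from∈ j)
pair-⊆ (there i)   (here refl) _   = inj₂ (refl ∷ from∈ i)
pair-⊆ (there i)   (there j)   a≢b = Sum.map (_ ∷ʳ_) (_ ∷ʳ_) (pair-⊆ i j a≢b)

-- If the first entry is neither minimum nor maximum, it has a smaller and a larger entry behind it,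
-- and these three form a 213 or a 231 according to their order.
Code-intro : Unique (x ∷ xs) →
  (∀ {a b c} → a ∷ b ∷ c ∷ [] ⊆ x ∷ xs → b < a → ¬ a < c) →
  (∀ {a b c} → a ∷ b ∷ c ∷ [] ⊆ x ∷ xs → c < a → ¬ a < b) → ∃[ w ] Code w (x ∷ xs)
Code-intro {xs = []} _ _ _ = [] , last
Code-intro {x} {xs@(_ ∷ _)} (x≢ ∷ uniq) no213 no231
  with w , c ← Code-intro uniq (no213 ∘ (x ∷ʳ_)) (no231 ∘ (x ∷ʳ_))
  with All.all? (x <?_) xs
... | yes l = false ∷ w , low l c
... | no ¬l with All.all? (_<? x) xs
...   | yes h = true ∷ w , high h c
...   | no ¬h
  with y , i , x≮y ← find (All.¬All⇒Any¬ (x <?_) xs ¬l)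
  with z , j , z≮x ← find (All.¬All⇒Any¬ (_<? x) xs ¬h) =
  ⊥-elim (Sum.[ (λ h → no213 (refl ∷ h) y<x x<z) , (λ h → no231 (refl ∷ h) y<x x<z) ]
    (pair-⊆ i j (<⇒≢ (<-trans y<x x<z))))
  where
  y<x = ≤∧≢⇒< (≮⇒≥ x≮y) (λ e → All.lookup x≢ i (sym e))
  x<z = ≤∧≢⇒< (≮⇒≥ z≮x) (All.lookup x≢ j)

max-split : Unique (x ∷ xs) → ∃₂ λ s m → ∃[ t ]
  x ∷ xs ≡ s ++ m ∷ t × All (_< m) s × All (_< m) t
max-split {x} {[]} _ = [] , x , [] , refl , [] , []
max-split {x} {_ ∷ _} (x≢ ∷ uniq) with s , m , t , eq , p , q ← max-split uniq with <-cmp x m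
... | tri< x<m _ _ = x ∷ s , m , t , cong (x ∷_) eq , x<m ∷ p , q
... | tri≈ _ x≡m _ = contradiction x≡m (All.lookup x≢ (subst (m ∈_) (sym eq) (∈-++⁺ʳ s (here refl))))
... | tri> _ _ m<x = 
  [] , x , _ , refl , [] , subst (All (_< x)) (sym eq) (All.++⁺ (All.map below p) (m<x ∷ All.map below q))
  where
  below : ∀ {y} → y < m → y < x
  below y<m = <-trans y<m m<x

Avoids1342 : List ℕ → Set
Avoids1342 σ = ∀ {r a b c d} → σ ↻ r → a ∷ b ∷ c ∷ d ∷ [] ⊆ r → a < d → d < b → ¬ b < c

-- Split at the maximum m as x ∷ s ++ m ∷ t, where x is the minimum. Avoiding 1342 forces s < t.
-- If x ∷ s increases, the list itself is coded; otherwise an inversion in x ∷ s forces t to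
-- decrease (2134), and the rotation m ∷ t ++ x ∷ s is coded.
avoids1342⇒Code : Unique (x ∷ xs) → All (x <_) xs → Avoids1342 (x ∷ xs) →
  ∃₂ λ w r → (x ∷ xs) ↻ r × Code w r
avoids1342⇒Code {x} uniq min av with max-split uniq
... | [] , _ , [] , refl , _ , _ = [] , _ , ↻-refl , last
... | [] , _ , _ ∷ _ , refl , _ , p ∷ _ = ⊥-elim (<-asym p (All.head min))
... | _ ∷ s , m , t , refl , s<m@(x<m ∷ _) , t<m = result
  where
  σ = x ∷ s ++ m ∷ t

  -- Two of the rotated forms of 1342: `rotated` forbids 2134 and `rotated′` forbids 4213.
  rotated : ∀ a b {c d} → a ∷ b ∷ c ∷ d ∷ [] ⊆ σ → b < a → a < c → ¬ c < d
  rotated a b h p q r with _ , rot , h′ ← ⊆-rotate-part h ([ a ] , _ , refl , refl) = av rot h′ p q r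

  rotated′ : ∀ a b {c d} → a ∷ b ∷ c ∷ d ∷ [] ⊆ σ → c < b → b < d → ¬ d < a
  rotated′ a b h p q r with _ , rot , h′ ← ⊆-rotate-part h (a ∷ b ∷ [] , _ , refl , refl) = av rot h′ p q r

  s<t : ∀ {y z} → y ∈ s → z ∈ t → y < z
  s<t {y} {z} i j with <-cmp y z
  ... | tri< y<z _ _ = y<z
  ... | tri≈ _ refl _ with (y≢z ∷ []) ∷ _ ← AllPairs-resp-⊆ (x ∷ʳ ++⁺ (from∈ i) (m ∷ʳ from∈ j)) uniq =
    contradiction refl y≢z
  -- The entries `x`, `y`, `m`, `z` would form a 1342.
  ... | tri> _ _ z<y = ⊥-elim (av ↻-refl (refl ∷ ++⁺ (from∈ i) (refl ∷ from∈ j))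
    (All.lookup min (∈-++⁺ʳ s (there j))) z<y (All.lookup s<m (there i)))

  xs<mt : All (λ y → All (y <_) (m ∷ t)) (x ∷ s)
  xs<mt = All.++⁻ʳ s min ∷ All.tabulate (λ i → All.lookup s<m (there i) ∷ All.tabulate (s<t i))

  -- In these four claims the minimum `x` or the maximum `m` completes the pattern: `m` before a 213
  -- gives 4213, `m` after it gives 2134, and `x` before a 231 gives 1342. If `x` or `m` already
  -- belongs to the triple, either its extremality refutes the triple or the completion still works.
  no213-t : ∀ {a b c} → a ∷ b ∷ c ∷ [] ⊆ m ∷ t → b < a → ¬ a < c
  no213-t (refl ∷ h) _   m<c = <-asym m<c (All.lookup t<m (Any-resp-⊆ h (there (here refl))))
  no213-t (_ ∷ʳ h)   b<a a<c = rotated′ m _ (++ˡ (x ∷ s) (refl ∷ h)) b<a a<c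
    (All.lookup t<m (Any-resp-⊆ h (there (there (here refl)))))

  no231-t : ∀ {a b c} → a ∷ b ∷ c ∷ [] ⊆ m ∷ t → c < a → ¬ a < b
  no231-t h c<a a<b = av ↻-refl (refl ∷ ++ˡ s h)
    (All.lookup (All.++⁻ʳ s min) (Any-resp-⊆ h (there (there (here refl))))) c<a a<b

  no213-s : ∀ {a b c} → a ∷ b ∷ c ∷ [] ⊆ x ∷ s → b < a → ¬ a < c
  no213-s h b<a a<c = rotated _ _ (++⁺ h (refl ∷ minimum t)) b<a a<c
    (All.lookup s<m (Any-resp-⊆ h (there (there (here refl)))))

  no231-s : ∀ {a b c} → a ∷ b ∷ c ∷ [] ⊆ x ∷ s → c < a → ¬ a < b
  no231-s h c<a a<b with h | All.lookup (All.++⁻ˡ s min)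
  ... | refl ∷ h′ | x<s = <-asym c<a (x<s (Any-resp-⊆ h′ (there (here refl))))
  ... | _ ∷ʳ h′   | x<s = av ↻-refl (refl ∷ ++ʳ (m ∷ t) h′)
    (x<s (Any-resp-⊆ h′ (there (there (here refl))))) c<a a<b

  uniq-s : Unique (x ∷ s)
  uniq-s = AllPairs-resp-⊆ (++ʳ (m ∷ t) ⊆-refl) uniq

  uniq-t : Unique (m ∷ t)
  uniq-t = AllPairs-resp-⊆ (++ˡ (x ∷ s) ⊆-refl) uniq

  result : ∃₂ λ w r → σ ↻ r × Code w r
  result with allPairs-or-counterexample _<?_ (x ∷ s)
  ... | inj₁ inc = _ , σ , ↻-refl , low-prefix⁺ inc xs<mt (proj₂ (Code-intro uniq-t no213-t no231-t))
  ... | inj₂ (a , b , h , a≮b) = _ , m ∷ t ++ x ∷ s , (x ∷ s , m ∷ t , refl , refl) ,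
    high-prefix⁺ (t<m ∷ t-decreasing) (s<m ∷ All-swap (All.map All.tail xs<mt))
      (proj₂ (Code-intro uniq-s no213-s no231-s))
    where
    b<a : b < a
    b<a with (a≢b ∷ []) ∷ _ ← AllPairs-resp-⊆ h uniq-s = ≤∧≢⇒< (≮⇒≥ a≮b) (a≢b ∘ sym)

    t-decreasing : AllPairs _>_ t
    t-decreasing with allPairs-or-counterexample _>?_ t
    ... | inj₁ dec = dec
    ... | inj₂ (c , d , h′ , c≯d) with (c≢d ∷ []) ∷ _ ← AllPairs-resp-⊆ (m ∷ʳ h′) uniq-t =
      ⊥-elim (rotated a b (++⁺ h (m ∷ʳ h′)) b<a
        (All.lookup (All.tail (All.lookup xs<mt (to∈′ h))) (to∈′ h′)) (≤∧≢⇒< (≮⇒≥ c≯d) c≢d))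
      where
      to∈′ : ∀ {a b as} → a ∷ b ∷ [] ⊆ as → a ∈ as
      to∈′ h = Any-resp-⊆ h (here refl)

    All-swap : All (λ y → All (y <_) t) (x ∷ s) → All (λ z → All (_< z) (x ∷ s)) t
    All-swap p = All.tabulate λ j → All.tabulate λ i → All.lookup (All.lookup p i) j

-- Enumerations of permutations and words

concatMap-unique : ∀ (f : A → List C) {as} → Unique as → All (Unique ∘ f) as →
  (∀ {a b c} → a ∈ as → b ∈ as → c ∈ f a → c ∈ f b → a ≡ b) → Unique (concatMap f as)
concatMap-unique f [] [] _ = []
concatMap-unique f {a ∷ as} (p ∷ ps) (q ∷ qs) inj =
  Unique.++⁺ q (concatMap-unique f ps qs (λ i j → inj (there i) (there j))) disjoint
  where
  disjoint : ∀ {c} → ¬ (c ∈ f a × c ∈ concatMap f as)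
  disjoint (i , j) with b , k , l ← find (∈-concatMap⁻ f {xs = as} j) =
    All.lookup p k (inj (here refl) (there k) i l)

∈insertions⁺ : ∀ p q → p ++ x ∷ q ∈ insertions x (p ++ q)
∈insertions⁺ []      []      = here refl
∈insertions⁺ []      (_ ∷ _) = here refl
∈insertions⁺ (y ∷ p) q       = there (∈-map⁺ (y ∷_) (∈insertions⁺ p q))

∈insertions⁻ : ∀ ys → zs ∈ insertions x ys → ∃₂ λ p q → ys ≡ p ++ q × zs ≡ p ++ x ∷ q
∈insertions⁻ []       (here refl) = [] , [] , refl , refl
∈insertions⁻ (y ∷ ys) (here refl) = [] , y ∷ ys , refl , refl
∈insertions⁻ (y ∷ ys) (there i) with _ , j , refl ← ∈-map⁻ (y ∷_) i
  with p , q , refl , refl ← ∈insertions⁻ ys j = y ∷ p , q , refl , refl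

insertions-unique : ∀ ys → x ∉ ys → Unique (insertions x ys)
insertions-unique []       _    = [] ∷ []
insertions-unique {x} (y ∷ ys) x∉ys =
  All.tabulate head≢ ∷ Unique.map⁺ ∷-injectiveʳ (insertions-unique ys (x∉ys ∘ there))
  where
  head≢ : ∀ {zs} → zs ∈ map (y ∷_) (insertions x ys) → x ∷ y ∷ ys ≢ zs
  head≢ i refl with _ , _ , eq ← ∈-map⁻ (y ∷_) i = x∉ys (here (∷-injectiveˡ eq))

remove-unique : ∀ p p′ {q q′} → x ∉ p ++ q → x ∉ p′ ++ q′ → p ++ x ∷ q ≡ p′ ++ x ∷ q′ → p ++ q ≡ p′ ++ q′
remove-unique []      []       _  _  eq = ∷-injectiveʳ eq
remove-unique []      (y ∷ p′) _  n′ eq = contradiction (here (∷-injectiveˡ eq)) n′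
remove-unique (y ∷ p) []       n  _  eq = contradiction (here (sym (∷-injectiveˡ eq))) n
remove-unique (y ∷ p) (z ∷ p′) n  n′ eq =
  cong₂ _∷_ (∷-injectiveˡ eq) (remove-unique p p′ (n ∘ there) (n′ ∘ there) (∷-injectiveʳ eq))

∈perms⁻ : ∀ n → xs ∈ perms n → xs ↭ applyDownFrom suc n
∈perms⁻ zero    (here refl) = ↭-refl
∈perms⁻ (suc n) i with ys , j , k ← find (∈-concatMap⁻ (insertions (suc n)) {xs = perms n} i)
  with p , q , refl , refl ← ∈insertions⁻ ys k = ↭-trans (shift (suc n) p q) (prep (suc n) (∈perms⁻ n j))

∈perms⁺ : ∀ n → xs ↭ applyDownFrom suc n → xs ∈ perms n
∈perms⁺ zero    h with ↭-length h
∈perms⁺ {[]} zero h | _ = here refl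
∈perms⁺ (suc n) h with p , q , refl ← ∈-∃++ (∈-resp-↭ (↭-sym h) (here refl)) =
  ∈-concatMap⁺ (insertions (suc n)) (lose (∈perms⁺ n
    (drop-∷ (↭-trans (↭-sym (shift (suc n) p q)) h))) (∈insertions⁺ p q))

perms-unique : ∀ n → Unique (perms n)
perms-unique zero = [] ∷ []
perms-unique (suc n) = concatMap-unique (insertions (suc n)) (perms-unique n)
  (All.tabulate λ i → insertions-unique _ (fresh i)) same
  where
  fresh : xs ∈ perms n → suc n ∉ xs
  fresh i j = n≮n n (All.lookup (All-resp-↭ {P = _≤ n} (↭-sym (∈perms⁻ n i)) (All.applyDownFrom⁺₁ suc n id)) j)

  same : xs ∈ perms n → ys ∈ perms n → zs ∈ insertions (suc n) xs → zs ∈ insertions (suc n) ys → xs ≡ ys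
  same {xs} {ys} i j k l with p , q , refl , refl ← ∈insertions⁻ xs k with p′ , q′ , refl , eq ← ∈insertions⁻ ys l =
    remove-unique p p′ (fresh i) (fresh j) eq

words : ℕ → List (List Bool)
words zero    = [] ∷ []
words (suc m) = map (false ∷_) (words m) ++ map (true ∷_) (words m)

∈words⁺ : ∀ w → w ∈ words (length w)
∈words⁺ []          = here refl
∈words⁺ (false ∷ w) = ∈-++⁺ˡ (∈-map⁺ _ (∈words⁺ w))
∈words⁺ (true ∷ w)  = ∈-++⁺ʳ (map (false ∷_) (words (length w))) (∈-map⁺ _ (∈words⁺ w))

∈words⁻ : ∀ m → w ∈ words m → length w ≡ m
∈words⁻ zero    (here refl) = refl
∈words⁻ (suc m) i with ∈-++⁻ (map (false ∷_) (words m)) i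
... | inj₁ j with _ , k , refl ← ∈-map⁻ _ j = cong suc (∈words⁻ m k)
... | inj₂ j with _ , k , refl ← ∈-map⁻ _ j = cong suc (∈words⁻ m k)

words-unique : ∀ m → Unique (words m)
words-unique zero    = [] ∷ []
words-unique (suc m) = Unique.++⁺
  (Unique.map⁺ ∷-injectiveʳ (words-unique m)) (Unique.map⁺ ∷-injectiveʳ (words-unique m)) disjoint
  where
  disjoint : ¬ (w ∈ map (false ∷_) (words m) × w ∈ map (true ∷_) (words m))
  disjoint (i , j) with _ , _ , refl ← ∈-map⁻ _ i with () ← proj₂ (proj₂ (∈-map⁻ _ j))

-- The partner of the first element is deleted from `cs`; by injectivity no later element needs it.
-- With a relation in place of a function, one relation and its converse give both inequalities
-- between two counts.
matching⇒length-≤ : ∀ {as : List A} {cs : List C} (R : A → C → Set) → Unique as →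
  (∀ {a} → a ∈ as → ∃[ c ] c ∈ cs × R a c) → (∀ {a a′ c} → R a c → R a′ c → a ≡ a′) →
  length as ≤ length cs
matching⇒length-≤ R [] _ _ = z≤n
matching⇒length-≤ {as = a ∷ as} R (a≢ ∷ uniq) match inj
  with c , i , r ← match (here refl) with p , q , refl ← ∈-∃++ i =
  subst (suc (length as) ≤_) (sym (↭-length (shift c p q)))
    (s≤s (matching⇒length-≤ R uniq match′ inj))
  where
  match′ : ∀ {a′} → a′ ∈ as → ∃[ d ] d ∈ p ++ q × R a′ d
  match′ j with d , k , r′ ← match (there j) with ∈-++⁻ p k
  ... | inj₁ l           = d , ∈-++⁺ˡ l , r′
  ... | inj₂ (here refl) = contradiction (inj r r′) (All.lookup a≢ j)
  ... | inj₂ (there l)   = d , ∈-++⁺ʳ p l , r′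

-- The permutations σ(w)

interval-shift : ∀ a k → applyDownFrom (a +_) (suc k) ↭ a ∷ applyDownFrom (suc a +_) k
interval-shift a zero    = ↭-reflexive (cong [_] (+-identityʳ a))
interval-shift a (suc k) rewrite +-suc a k =
  ↭-trans (prep _ (interval-shift a k)) (swap _ _ ↭-refl)

sigmaAux-↭ : ∀ lo w → sigmaAux lo (lo + length w) w ↭ applyDownFrom (lo +_) (suc (length w))
sigmaAux-↭ lo [] = ↭-reflexive (cong [_] (sym (+-identityʳ lo)))
sigmaAux-↭ lo (false ∷ w) = ↭-trans (prep lo
  (subst (λ k → sigmaAux (suc lo) k w ↭ applyDownFrom (suc lo +_) (suc (length w)))
    (sym (+-suc lo (length w))) (sigmaAux-↭ (suc lo) w)))
  (↭-sym (interval-shift lo (suc (length w))))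
sigmaAux-↭ lo (true ∷ w) rewrite +-suc lo (length w) = prep _ (sigmaAux-↭ lo w)

Code-sigmaAux : ∀ lo w → Code w (sigmaAux lo (lo + length w) w)
Code-sigmaAux lo [] = last
Code-sigmaAux lo (false ∷ w) rewrite +-suc lo (length w) = low
  (All-resp-↭ (↭-sym (sigmaAux-↭ (suc lo) w)) (All.applyDownFrom⁺₂ (suc lo +_) _ (λ i → s≤s (m≤m+n lo i))))
  (Code-sigmaAux (suc lo) w)
Code-sigmaAux lo (true ∷ w) rewrite +-suc lo (length w) = high
  (All-resp-↭ (↭-sym (sigmaAux-↭ lo w)) (All.applyDownFrom⁺₁ (lo +_) _ (λ i<k → s≤s (+-monoʳ-≤ lo (s≤s⁻¹ i<k)))))
  (Code-sigmaAux lo w)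

Code-sigma : ∀ w → Code w (sigma w)
Code-sigma = Code-sigmaAux 1

-- Circular avoiders correspond to words

¬Code-intermediate : ∀ p → y ∈ s → zs ≡ p ++ x ∷ s → y < x → ∀ {z} → z ∈ s → x < z → ¬ Code w zs
¬Code-intermediate []      i refl y<x j x<z (low l _)  = <-asym y<x (All.lookup l i)
¬Code-intermediate []      i refl y<x j x<z (high h _) = <-asym x<z (All.lookup h j)
¬Code-intermediate {w = []} (_ ∷ p) _ refl _ _ _ c = ¬Code-[] p c
¬Code-intermediate (_ ∷ p) i refl y<x j x<z (low _ c)  = ¬Code-intermediate p i refl y<x j x<z c
¬Code-intermediate (_ ∷ p) i refl y<x j x<z (high _ c) = ¬Code-intermediate p i refl y<x j x<z c

Coded : List ℕ → Set
Coded σ = ∃₂ λ w r → σ ↻ r × Code w r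

¬Contains1342⇒Avoids1342 : ∀ {σ} → ¬ Contains σ p1342 → Avoids1342 σ
¬Contains1342⇒Avoids1342 ¬c {r} rot sub a<d d<b b<c = ¬c (r , _ , rot , sub , concordant⇒≅ tt
  ( (inj₁ (<-trans a<d d<b , s≤s (s≤s z≤n)) ∷ inj₁ (<-trans a<d (<-trans d<b b<c) , s≤s (s≤s z≤n))
      ∷ inj₁ (a<d , ≤-refl) ∷ [])
  ∷ (inj₁ (b<c , ≤-refl) ∷ inj₂ (d<b , ≤-refl) ∷ [])
  ∷ (inj₂ (<-trans d<b b<c , s≤s (s≤s (s≤s z≤n))) ∷ [])
  ∷ [] ∷ []))

Code-↻-⊆ : (x ∷ s) ↻ t → t ⊆ xs → Code w xs → ∃[ u ] u ⊆ w × Code u t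
Code-↻-⊆ {t = []}    rot _ _ with () ← ↭-length (↻⇒↭ rot)
Code-↻-⊆ {t = _ ∷ _} _ sub c = Code-⊆⁻ c sub

-- Each rotation has an entry with a smaller and a larger one behind it: in 1342 and 3421 the 3
-- precedes both 2 and 4, in 4213 and 2134 the 2 precedes both 1 and 3.
¬↻-Code-1342 : ∀ {a b c d} → a < d → d < b → b < c → (a ∷ b ∷ c ∷ d ∷ []) ↻ xs → ¬ Code w xs
¬↻-Code-1342 {a = a} a<d d<b b<c (p , q , e , refl) with p | q | e
... | [] | _ | refl = ¬Code-intermediate [ a ] (there (here refl)) refl d<b (here refl) b<c
... | _ ∷ [] | _ | refl = ¬Code-intermediate [] (there (here refl)) refl d<b (here refl) b<c
... | _ ∷ _ ∷ [] | _ | refl = ¬Code-intermediate [ _ ] (here refl) refl a<d (there (here refl)) d<b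
... | _ ∷ _ ∷ _ ∷ [] | _ | refl = ¬Code-intermediate [] (here refl) refl a<d (there (here refl)) d<b
... | _ ∷ _ ∷ _ ∷ _ ∷ [] | _ | refl = ¬Code-intermediate [ a ] (there (here refl)) refl d<b (here refl) b<c

≅-< : ∀ {a b c d} → s ≅ t → (a , b) ∈ zip s t → (c , d) ∈ zip s t → b < d → a < c
≅-< iso i j b<d = <ᵇ⇒< _ _ (subst T (sym (same-order iso i j)) (<⇒<ᵇ b<d))

Coded⇒¬Contains1342 : ∀ {σ} → Coded σ → ¬ Contains σ p1342
Coded⇒¬Contains1342 (w , r , rot , c) (r′ , s , rot′ , sub , iso)
  with t , rot″ , sub′ ← ⊆-rotate-whole sub (↻-trans (↻-sym rot′) rot)
  with s | iso
... | [] | iso with () ← same-length iso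
... | _ ∷ [] | iso with () ← same-length iso
... | _ ∷ _ ∷ [] | iso with () ← same-length iso
... | _ ∷ _ ∷ _ ∷ [] | iso with () ← same-length iso
... | _ ∷ _ ∷ _ ∷ _ ∷ _ ∷ _ | iso with () ← same-length iso
... | _ ∷ _ ∷ _ ∷ _ ∷ [] | iso = ¬↻-Code-1342
  (≅-< iso (here refl) (there (there (there (here refl)))) (s≤s (s≤s z≤n)))
  (≅-< iso (there (there (there (here refl)))) (there (here refl)) (s≤s (s≤s (s≤s z≤n))))
  (≅-< iso (there (here refl)) (there (there (here refl))) (s≤s (s≤s (s≤s (s≤s z≤n)))))
  rot″ (proj₂ (proj₂ (Code-↻-⊆ rot″ sub′ c)))

-- By the dual word, circular containment of σ(0^{a+1}1^b) becomes a condition on subwords.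
Occurs : ℕ → ℕ → List Bool → Set
Occurs a b w = word a b ⊆ w ⊎ dual a b ⊆ w

Excluded : List Bool → Set
Excluded w = ∃₂ λ a b → w ≡ dual a b

module _ {B : Set} {x y : B} (x≢y : x ≢ y) where
  blocks-injective : ∀ i k {j l} → replicate i x ++ replicate j y ≡ replicate k x ++ replicate l y → i ≡ k × j ≡ l
  blocks-injective zero    zero    {j} {l} eq =
    refl , trans (sym (length-replicate j)) (trans (cong length eq) (length-replicate l))
  blocks-injective zero    (suc k) {suc j} eq = contradiction (sym (∷-injectiveˡ eq)) x≢y
  blocks-injective (suc i) zero    {l = suc l} eq = contradiction (∷-injectiveˡ eq) x≢y
  blocks-injective (suc i) (suc k) eq with refl , e ← blocks-injective i k (∷-injectiveʳ eq) = refl , e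

word-injective : ∀ {a b c d} → word a b ≡ word c d → a ≡ c × b ≡ d
word-injective {a} {b} {c} {d} eq with refl , e ← blocks-injective (λ ()) (suc a) (suc c) eq = refl , e

dual-injective : ∀ {a b c d} → dual a b ≡ dual c d → a ≡ c × b ≡ d
dual-injective {a} {b} {c} {d} eq with refl , e ← blocks-injective (λ ()) (suc b) (suc d) eq = e , refl

-- A sublist coded by the dual word is a rotation of the pattern; rotating the whole list along with
-- it puts the pattern in place.
Occurs⇒Contains : ∀ a b {σ r} → σ ↻ r → Code w r → Occurs a b w → Contains σ (sigma (word a b))
Occurs⇒Contains a b rot c (inj₁ sub) with s , sub′ , d ← Code-⊆⁺ c sub =
  _ , s , rot , sub′ , Code⇒≅ d (Code-sigma (word a b))
Occurs⇒Contains a b rot c (inj₂ sub)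
  with s , sub′ , d ← Code-⊆⁺ c sub
  with t , rot′ , d′ ← dual-↻-word a b d
  with u , rot″ , sub″ ← ⊆-rotate-part sub′ rot′ =
  u , t , ↻-trans rot rot″ , sub″ , Code⇒≅ d′ (Code-sigma (word a b))

Contains⇒Occurs : ∀ a b {σ r} → σ ↻ r → Code w r → Contains σ (sigma (word a b)) → Occurs a b w
Contains⇒Occurs a b rot c (r′ , [] , rot′ , sub , iso) with () ← ≅-Code iso (Code-sigma (word a b))
Contains⇒Occurs a b rot c (r′ , s@(_ ∷ _) , rot′ , sub , iso)
  with t , rot″ , sub′ ← ⊆-rotate-whole sub (↻-trans (↻-sym rot′) rot)
  with u , sub″ , d ← Code-↻-⊆ rot″ sub′ c
  with Code-↻ (≅-Code iso (Code-sigma (word a b))) d rot″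
... | inj₁ refl = inj₁ sub″
... | inj₂ (inj₁ (p , q , e , refl)) with refl , refl ← word-injective {a} {b} {p} {q} e = inj₂ sub″
-- A dual word begins with 1, whereas `word a b` begins with 0.
... | inj₂ (inj₂ (p , q , _ , ()))

T-not⁺ : ∀ {b} → ¬ T b → T (not b)
T-not⁺ {false} _ = tt
T-not⁺ {true}  n = n tt

T-not⁻ : ∀ {b} → T (not b) → ¬ T b
T-not⁻ {true} ()

avoidsAll⇒¬Contains : ∀ {π ρ} → T (avoidsAll (π ∷ ρ ∷ []) (x ∷ xs)) →
  ¬ Contains (x ∷ xs) π × ¬ Contains (x ∷ xs) ρ
avoidsAll⇒¬Contains {x} {xs} {π} {ρ} h
  with p , h′ ← Equivalence.to (T-∧ {not (containsCirc (x ∷ xs) π)}) h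
  with q , _ ← Equivalence.to (T-∧ {not (containsCirc (x ∷ xs) ρ)}) h′ =
  T-not⁻ p ∘ Contains⇒containsCirc , T-not⁻ q ∘ Contains⇒containsCirc

¬Contains⇒avoidsAll : ∀ {σ π ρ} → ¬ Contains σ π → ¬ Contains σ ρ → T (avoidsAll (π ∷ ρ ∷ []) σ)
¬Contains⇒avoidsAll {σ} {π} {ρ} p q = Equivalence.from T-∧
  ( T-not⁺ (p ∘ containsCirc⇒Contains σ π)
  , Equivalence.from T-∧ (T-not⁺ (q ∘ containsCirc⇒Contains σ ρ) , tt))

onesZeros? : Decidable (λ w → ∃₂ λ i j → w ≡ replicate i true ++ replicate j false)
onesZeros? [] = yes (0 , 0 , refl)
onesZeros? (true ∷ w) with onesZeros? w
... | yes (i , j , refl) = yes (suc i , j , refl)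
... | no ¬p = no λ { (zero , suc j , ()) ; (suc i , j , e) → ¬p (i , j , ∷-injectiveʳ e) }
onesZeros? (false ∷ w) with ≡-dec Bool._≟_ w (replicate (length w) false)
... | yes e = yes (0 , suc (length w) , cong (false ∷_) e)
... | no ¬e = no λ { (zero , suc j , refl) → ¬e (sym (cong (λ k → replicate k false) (length-replicate j))) }

excluded? : Decidable Excluded
excluded? []          = no λ ()
excluded? (false ∷ _) = no λ ()
excluded? (true ∷ w)  = map′ (λ (i , j , e) → j , i , cong (true ∷_) e)
  (λ (a , b , e) → b , a , ∷-injectiveʳ e) (onesZeros? w)

occurs? : ∀ a b → Decidable (Occurs a b)
occurs? a b w = (word a b ⊆? w) ⊎-dec (dual a b ⊆? w)

Reduced-avoiding : ℕ → ℕ → List Bool → Set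
Reduced-avoiding a b w = ¬ Excluded w × ¬ Occurs a b w

reduced-avoiding? : ∀ a b → Decidable (Reduced-avoiding a b)
reduced-avoiding? a b w = ¬? (excluded? w) ×-dec ¬? (occurs? a b w)

-- Representatives of rotation classes and their words

Canonical : ℕ → List ℕ → Set
Canonical m σ = ∃[ τ ] σ ≡ 1 ∷ τ × σ ↭ applyDownFrom suc (suc m)

range-unique : ∀ n → Unique (applyDownFrom suc n)
range-unique n = Unique.applyDownFrom⁺₁ suc n (λ j<i _ e → <⇒≢ j<i (sym (suc-injective e)))

Unique-resp-↭ : xs ↭ ys → Unique xs → Unique ys
Unique-resp-↭ p = Perm.Unique-resp-↭ (setoid ℕ) (↭⇒↭ₛ p)

↻-same-head : Unique (x ∷ xs) → (x ∷ xs) ↻ (x ∷ ys) → xs ≡ ys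
↻-same-head _ ([] , q , refl , eq) = sym (trans (∷-injectiveʳ eq) (++-identityʳ _))
↻-same-head _ (x ∷ p , [] , refl , refl) = ++-identityʳ p
↻-same-head (x≢ ∷ _) (x ∷ p , _ ∷ q , refl , refl) = contradiction refl (All.lookup x≢ (∈-++⁺ʳ p (here refl)))

∈circPerms⁻ : ∀ m {σ} → σ ∈ circPerms (suc m) → Canonical m σ
∈circPerms⁻ m {σ} i with ∈-filter⁻ (λ π → T? (startsWith1 π)) {xs = perms (suc m)} i
∈circPerms⁻ m {x ∷ τ} _ | j , h with refl ← ≡ᵇ⇒≡ x 1 h = τ , refl , ∈perms⁻ (suc m) j

∈circPerms⁺ : ∀ m {σ} → Canonical m σ → σ ∈ circPerms (suc m)
∈circPerms⁺ m (τ , refl , p) = ∈-filter⁺ (λ π → T? (startsWith1 π)) (∈perms⁺ (suc m) p) tt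

record Represents (m : ℕ) (w : List Bool) (σ : List ℕ) : Set where
  constructor rep
  field
    {rotation} : List ℕ
    canonical  : Canonical m σ
    reduced    : ¬ Excluded w
    rotates    : σ ↻ rotation
    code       : Code w rotation

-- The coded rotations of the two lists share code and entries and therefore coincide; as the value
-- 1 occurs once, a rotation class has only one member beginning with it.
Represents-functional : ∀ {m σ σ′} → Represents m w σ → Represents m w σ′ → σ ≡ σ′
Represents-functional (rep (τ , refl , p) _ rot c) (rep (τ′ , refl , p′) _ rot′ c′)
  with refl ← Code-injective-↭ c c′ (↭-trans (↭-sym (↻⇒↭ rot)) (↭-trans p (↭-trans (↭-sym p′) (↻⇒↭ rot′)))) =
  cong (1 ∷_) (↻-same-head (Unique-resp-↭ (↭-sym p) (range-unique _)) (↻-trans rot (↻-sym rot′)))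

Represents-injective : ∀ {m σ} → Represents m w σ → Represents m w′ σ → w ≡ w′
Represents-injective (rep _ red rot c) (rep _ red′ rot′ c′) with Code-↻ c c′ (↻-trans (↻-sym rot) rot′)
... | inj₁ e = e
... | inj₂ (inj₁ (a , b , _ , e)) = contradiction (a , b , e) red′
... | inj₂ (inj₂ (a , b , _ , e)) = contradiction (a , b , e) red

reduce : ∀ {σ} → Coded σ → ∃₂ λ w r → ¬ Excluded w × σ ↻ r × Code w r
reduce (w , r , rot , c) with excluded? w
... | no ¬e = w , r , ¬e , rot , c
... | yes (a , b , refl) with r′ , rot′ , c′ ← dual-↻-word a b c =
  word a b , r′ , (λ ()) , ↻-trans rot rot′ , c′

avoiders : ℕ → ℕ → ℕ → List (List ℕ)
avoiders a b m = filter (λ σ → T? (avoidsAll (p1342 ∷ sigma (word a b) ∷ []) σ)) (circPerms (suc m))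

canonical-minimal : ∀ n → (1 ∷ xs) ↭ applyDownFrom suc n → All (1 <_) xs
canonical-minimal n p
  with _ ∷ pos ← All-resp-↭ {P = 1 ≤_} (↭-sym p) (All.applyDownFrom⁺₂ suc n (λ _ → s≤s z≤n))
  with 1≢ ∷ _ ← Unique-resp-↭ (↭-sym p) (range-unique n) =
  All.zipWith (λ (q , r) → ≤∧≢⇒< q r) (pos , 1≢)

code-of-size : ∀ m → xs ↭ applyDownFrom suc (suc m) → Code w xs → length w ≡ m
code-of-size m p c = suc-injective (trans (sym (Code-length c)) (trans (↭-length p) (length-applyDownFrom suc (suc m))))

avoider⇒word : ∀ a b m {σ} → σ ∈ avoiders a b m →
  ∃[ w ] w ∈ filter (reduced-avoiding? a b) (words m) × Represents m w σ
avoider⇒word a b m i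
  with j , h ← ∈-filter⁻ (λ σ → T? (avoidsAll (p1342 ∷ sigma (word a b) ∷ []) σ)) {xs = circPerms (suc m)} i
  with can@(τ , refl , p) ← ∈circPerms⁻ m j
  with no1342 , noσ ← avoidsAll⇒¬Contains {π = p1342} {sigma (word a b)} h
  with w , r , red , rot , c ← reduce (avoids1342⇒Code (Unique-resp-↭ (↭-sym p) (range-unique (suc m)))
         (canonical-minimal (suc m) p) (¬Contains1342⇒Avoids1342 no1342)) =
  w , ∈-filter⁺ (reduced-avoiding? a b)
        (subst (λ k → w ∈ words k) (code-of-size m (↭-trans (↭-sym (↻⇒↭ rot)) p) c) (∈words⁺ w))
        (red , noσ ∘ Occurs⇒Contains a b rot c) ,
  rep can red rot c

word⇒avoider : ∀ a b m {w} → w ∈ filter (reduced-avoiding? a b) (words m) →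
  ∃[ σ ] σ ∈ avoiders a b m × Represents m w σ
word⇒avoider a b m {w} i
  with j , red , noccurs ← ∈-filter⁻ (reduced-avoiding? a b) {xs = words m} i
  with refl ← ∈words⁻ m j
  -- Cutting `sigma w` just before its value 1 and swapping the blocks yields the canonical
  -- representative.
  with p , q , e ← ∈-∃++ (∈-resp-↭ (↭-trans (↭-sym (interval-shift 1 m)) (↭-sym (sigmaAux-↭ 1 w))) (here refl)) =
  1 ∷ q ++ p ,
  ∈-filter⁺ _ (∈circPerms⁺ m can)
    (¬Contains⇒avoidsAll {1 ∷ q ++ p} {p1342} {sigma (word a b)}
      (Coded⇒¬Contains1342 (w , sigma w , rot , Code-sigma w))
      (noccurs ∘ Contains⇒Occurs a b rot (Code-sigma w))) ,
  rep can red rot (Code-sigma w)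
  where
  rot : (1 ∷ q ++ p) ↻ sigma w
  rot = ↻-sym (p , 1 ∷ q , e , refl)

  can : Canonical m (1 ∷ q ++ p)
  can = q ++ p , refl , ↭-trans (↻⇒↭ rot) (sigmaAux-↭ 1 w)

avCount≡count-words : ∀ a b m →
  avCount (p1342 ∷ sigma (word a b) ∷ []) (suc m) ≡ length (filter (reduced-avoiding? a b) (words m))
avCount≡count-words a b m = ≤-antisym
  (matching⇒length-≤ (λ σ w → Represents m w σ)
    (Unique.filter⁺ _ (Unique.filter⁺ _ (perms-unique (suc m)))) (avoider⇒word a b m) Represents-functional)
  (matching⇒length-≤ (Represents m)
    (Unique.filter⁺ _ (words-unique m)) (word⇒avoider a b m) Represents-injective)

-- Counting words

# : {A : Set} {P : A → Set} → Decidable P → List A → ℕ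
# P? as = length (filter P? as)

module _ {A : Set} {P Q : A → Set} (P? : Decidable P) (Q? : Decidable Q) where

  #-splitˡ : ∀ as → # P? as ≡ # (λ a → P? a ×-dec Q? a) as + # (λ a → P? a ×-dec ¬? (Q? a)) as
  #-splitˡ [] = refl
  #-splitˡ (a ∷ as) with P? a | Q? a
  ... | yes _ | yes _ = cong suc (#-splitˡ as)
  ... | yes _ | no _  = trans (cong suc (#-splitˡ as)) (sym (+-suc _ _))
  ... | no _  | yes _ = #-splitˡ as
  ... | no _  | no _  = #-splitˡ as

  #-splitʳ : ∀ as → # Q? as ≡ # (λ a → P? a ×-dec Q? a) as + # (λ a → ¬? (P? a) ×-dec Q? a) as
  #-splitʳ [] = refl
  #-splitʳ (a ∷ as) with P? a | Q? a
  ... | yes _ | yes _ = cong suc (#-splitʳ as)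
  ... | yes _ | no _  = #-splitʳ as
  ... | no _  | yes _ = trans (cong suc (#-splitʳ as)) (sym (+-suc _ _))
  ... | no _  | no _  = #-splitʳ as

  #-∪-∩ : ∀ as → # (λ a → P? a ⊎-dec Q? a) as + # (λ a → P? a ×-dec Q? a) as ≡ # P? as + # Q? as
  #-∪-∩ [] = refl
  #-∪-∩ (a ∷ as) with P? a | Q? a
  ... | yes _ | yes _ = cong suc (trans (+-suc _ _) (trans (cong suc (#-∪-∩ as)) (sym (+-suc _ _))))
  ... | yes _ | no _  = cong suc (#-∪-∩ as)
  ... | no _  | yes _ = trans (cong suc (#-∪-∩ as)) (sym (+-suc _ _))
  ... | no _  | no _  = #-∪-∩ as

  -- Equal counts carry a witness of known length from one pair of parameters to the other, where
  -- lower bounds on lengths then apply.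
  #-transfer : ∀ {as cs a} → # P? as ≡ # Q? cs → a ∈ as → P a → ∃[ c ] c ∈ cs × Q c
  #-transfer {as} {cs} eq i p with filter P? as | ∈-filter⁺ P? i p | filter Q? cs in eq′
  ... | _ ∷ _ | _ | c ∷ _ = c , ∈-filter⁻ Q? (subst (c ∈_) (sym eq′) (here refl))
  ... | _ ∷ _ | _ | [] with () ← eq

#-map : {A C : Set} {P : C → Set} {Q : A → Set} (P? : Decidable P) (Q? : Decidable Q) (f : A → C) →
  (∀ {a} → P (f a) → Q a) → (∀ {a} → Q a → P (f a)) → ∀ as → # P? (map f as) ≡ # Q? as
#-map P? Q? f to from [] = refl
#-map P? Q? f to from (a ∷ as) with P? (f a) | Q? a
... | yes _ | yes _ = cong suc (#-map P? Q? f to from as)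
... | no _  | no _  = #-map P? Q? f to from as
... | yes p | no ¬q = contradiction (to p) ¬q
... | no ¬p | yes q = contradiction (from q) ¬p

#-++ : {A : Set} {P : A → Set} (P? : Decidable P) → ∀ as bs → # P? (as ++ bs) ≡ # P? as + # P? bs
#-++ P? as bs = trans (cong length (filter-++ P? as bs)) (length-++ (filter P? as))

-- A first letter equal to `x` may be matched greedily, and the other letter is skipped. The
-- recursion is the same for both values of `x`, so the letters of a subword do not affect its
-- count.
#-subword-∷ : ∀ x v m → # (x ∷ v ⊆?_) (words (suc m)) ≡ # (v ⊆?_) (words m) + # (x ∷ v ⊆?_) (words m)
#-subword-∷ false v m = trans (#-++ (false ∷ v ⊆?_) (map (false ∷_) (words m)) _) (cong₂ _+_
  (#-map (false ∷ v ⊆?_) (v ⊆?_) (false ∷_) ∷⁻ (refl ∷_) (words m))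
  (#-map (false ∷ v ⊆?_) (false ∷ v ⊆?_) (true ∷_) (∷ʳ⁻ λ ()) (true ∷ʳ_) (words m)))
#-subword-∷ true v m = trans (#-++ (true ∷ v ⊆?_) (map (false ∷_) (words m)) _) (trans (cong₂ _+_
  (#-map (true ∷ v ⊆?_) (true ∷ v ⊆?_) (false ∷_) (∷ʳ⁻ λ ()) (false ∷ʳ_) (words m))
  (#-map (true ∷ v ⊆?_) (v ⊆?_) (true ∷_) ∷⁻ (refl ∷_) (words m)))
  (+-comm (# (true ∷ v ⊆?_) (words m)) _))

#-subword-length : ∀ m v v′ → length v ≡ length v′ → # (v ⊆?_) (words m) ≡ # (v′ ⊆?_) (words m)
#-subword-length m       []      []        _  = refl
#-subword-length zero    (_ ∷ _) (_ ∷ _)   _  = refl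
#-subword-length (suc m) (x ∷ v) (x′ ∷ v′) eq = trans (#-subword-∷ x v m) (trans
  (cong₂ _+_ (#-subword-length m v v′ (suc-injective eq)) (#-subword-length m (x ∷ v) (x′ ∷ v′) eq))
  (sym (#-subword-∷ x′ v′ m)))

-- Letter counts and the shortest words containing both subwords

letters : Bool → List Bool → ℕ
letters b = # (b Bool.≟_)

letters-mono : ∀ b → v ⊆ w → letters b v ≤ letters b w
letters-mono b h = length-mono-≤ (⊆-filter-Sublist (b Bool.≟_) (b Bool.≟_) (λ { refl p → p }) h)

letters-total : ∀ w → letters false w + letters true w ≡ length w
letters-total []          = refl
letters-total (false ∷ w) = cong suc (letters-total w)
letters-total (true ∷ w)  = trans (+-suc _ _) (cong suc (letters-total w))

letters-block : ∀ b k → letters b (replicate k b) ≡ k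
letters-block b k = trans (cong length (filter-all (b Bool.≟_) (All.replicate⁺ k refl))) (length-replicate k)

letters-other : ∀ b c k → b ≢ c → letters b (replicate k c) ≡ 0
letters-other b c k b≢c = cong length (filter-none (b Bool.≟_) (All.replicate⁺ k b≢c))

letters-blocksˡ : ∀ b c i j → b ≢ c → letters b (replicate i b ++ replicate j c) ≡ i
letters-blocksˡ b c i j b≢c = trans (#-++ (b Bool.≟_) (replicate i b) _)
  (trans (cong₂ _+_ (letters-block b i) (letters-other b c j b≢c)) (+-identityʳ i))

letters-blocksʳ : ∀ b c i j → c ≢ b → letters c (replicate i b ++ replicate j c) ≡ j
letters-blocksʳ b c i j c≢b = trans (#-++ (c Bool.≟_) (replicate i b) _)
  (cong₂ _+_ (letters-other c b i c≢b) (letters-block c j))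

length-blocks : ∀ {b c : Bool} i j → length (replicate i b ++ replicate j c) ≡ i + j
length-blocks {b} i j = trans (length-++ (replicate i b)) (cong₂ _+_ (length-replicate i) (length-replicate j))

length-word : ∀ a b → length (word a b) ≡ suc (a + b)
length-word a b = length-blocks (suc a) b

length-dual : ∀ a b → length (dual a b) ≡ suc (a + b)
length-dual a b = trans (length-blocks (suc b) a) (cong suc (+-comm b a))

-- The occurrences of 0^i 1^j and 1^k 0^l share only zeros or only ones, so either
-- their zeros or their ones can be taken disjoint.
disjoint-letters : ∀ i j k l →
  replicate i false ++ replicate j true ⊆ w → replicate k true ++ replicate l false ⊆ w →
  i + l ≤ letters false w ⊎ k + j ≤ letters true w
disjoint-letters zero j k l _ q =
  inj₁ (≤-trans (≤-reflexive (sym (letters-blocksʳ true false k l λ ()))) (letters-mono false q))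
disjoint-letters (suc i) j zero l p _ =
  inj₂ (≤-trans (≤-reflexive (sym (letters-blocksʳ false true (suc i) j λ ()))) (letters-mono true p))
disjoint-letters {false ∷ w} (suc i) j (suc k) l p q = Sum.map₁ s≤s (disjoint-letters i j (suc k) l (∷⁻ p) (∷ʳ⁻ (λ ()) q))
disjoint-letters {true ∷ w}  (suc i) j (suc k) l p q = Sum.map₂ s≤s (disjoint-letters (suc i) j k l (∷ʳ⁻ (λ ()) p) (∷⁻ q))

Both : ℕ → ℕ → List Bool → Set
Both a b w = word a b ⊆ w × dual a b ⊆ w

both? : ∀ a b → Decidable (Both a b)
both? a b w = (word a b ⊆? w) ×-dec (dual a b ⊆? w)

-- With disjoint zeros `w` has at least `(a + 1) + a` of them, besides the `b + 1` ones of the dual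
-- word. With disjoint ones it has at least `(b + 1) + b` of them, besides the `a + 1` zeros of
-- `word a b`.
Both-length : ∀ a b → Both a b w → suc (suc (a + b)) + a ≤ length w ⊎ suc (suc (a + b)) + b ≤ length w
Both-length {w} a b (p , q) = Sum.map
  (λ h → ≤-trans (≤-reflexive eq₁) (≤-trans (+-mono-≤ h ones) (≤-reflexive (letters-total w))))
  (λ h → ≤-trans (≤-reflexive eq₂) (≤-trans (+-mono-≤ zeros h) (≤-reflexive (letters-total w))))
  (disjoint-letters (suc a) b (suc b) a p q)
  where
  open +-*-Solver

  zeros : suc a ≤ letters false w
  zeros = ≤-trans (≤-reflexive (sym (letters-blocksˡ false true (suc a) b λ ()))) (letters-mono false p)

  ones : suc b ≤ letters true w
  ones = ≤-trans (≤-reflexive (sym (letters-blocksˡ true false (suc b) a λ ()))) (letters-mono true q)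

  eq₁ : suc (suc (a + b)) + a ≡ (suc a + a) + suc b
  eq₁ = solve 2 (λ a b → con 2 :+ (a :+ b) :+ a := (con 1 :+ a :+ a) :+ (con 1 :+ b)) refl a b

  eq₂ : suc (suc (a + b)) + b ≡ suc a + (suc b + b)
  eq₂ = solve 2 (λ a b → con 2 :+ (a :+ b) :+ b := (con 1 :+ a) :+ (con 1 :+ b :+ b)) refl a b

CommonSuperword : ℕ → ℕ → ℕ → Set
CommonSuperword a b m = ∃[ w ] w ∈ words m × Both a b w

superword-of-length : ∀ a b {m} w → length w ≡ m → Both a b w → CommonSuperword a b m
superword-of-length a b w refl both = w , ∈words⁺ w , both

-- The word 0^{a+1}1^{b+1}0^a, in which the two subwords share ones only; it attains the first bound
-- of `Both-length`.
common-superwordˡ : ∀ a b → CommonSuperword a b (suc (suc (a + b)) + a)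
common-superwordˡ a b = superword-of-length a b (replicate (suc a) false ++ dual a b)
  (trans (length-++ (replicate (suc a) false)) (trans (cong₂ _+_ (length-replicate (suc a)) (length-dual a b))
    (trans (+-comm (suc a) (suc (a + b))) (cong suc (+-suc (a + b) a)))))
  ( ++⁺ (⊆-refl {x = replicate (suc a) false}) (++ʳ (replicate a false) (true ∷ʳ ⊆-refl))
  , ++ˡ (replicate (suc a) false) ⊆-refl)

-- The word 1^{b+1}0^{a+1}1^b, in which the two subwords share zeros only; it attains the second
-- bound of `Both-length`.
common-superwordʳ : ∀ a b → CommonSuperword a b (suc (suc (a + b)) + b)
common-superwordʳ a b = superword-of-length a b (replicate (suc b) true ++ word a b)
  (trans (length-++ (replicate (suc b) true)) (trans (cong₂ _+_ (length-replicate (suc b)) (length-word a b))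
    (trans (+-comm (suc b) (suc (a + b))) (cong suc (+-suc (a + b) b)))))
  ( ++ˡ (replicate (suc b) true) ⊆-refl
  , ++⁺ (⊆-refl {x = replicate (suc b) true}) (++ʳ (replicate b true) (false ∷ʳ ⊆-refl)))

-- Excluded words and inclusion-exclusion

Excluded-Occurs : ℕ → ℕ → List Bool → Set
Excluded-Occurs a b w = Excluded w × Occurs a b w

excluded-occurs? : ∀ a b → Decidable (Excluded-Occurs a b)
excluded-occurs? a b w = excluded? w ×-dec occurs? a b w

Occurs-dual⇒≤ : ∀ a b p q → Occurs a b (dual p q) → a ≤ p × b ≤ q
Occurs-dual⇒≤ a b p q (inj₂ h) =
  subst₂ _≤_ (letters-blocksʳ true false (suc b) a λ ()) (letters-blocksʳ true false (suc q) p λ ())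
    (letters-mono false h) ,
  s≤s⁻¹ (subst₂ _≤_ (letters-blocksˡ true false (suc b) a λ ()) (letters-blocksˡ true false (suc q) p λ ())
    (letters-mono true h))
-- The leading zero of `word a b` pushes the whole embedding past the ones of `dual p q`, so it lies
-- among zeros and `b` must be 0.
Occurs-dual⇒≤ a b p q (inj₁ h) =
  <⇒≤ (subst₂ _≤_ (letters-blocksˡ false true (suc a) b λ ()) (letters-blocksʳ true false (suc q) p λ ())
    (letters-mono false h)) ,
  ≤-trans (subst₂ _≤_ (letters-blocksʳ false true (suc a) b λ ()) (letters-other true false p λ ())
    (letters-mono true (in-zeros (suc q) h))) z≤n
  where
  in-zeros : ∀ i → false ∷ v ⊆ replicate i true ++ w → false ∷ v ⊆ w
  in-zeros zero    h = h
  in-zeros (suc i) h = in-zeros i (∷ʳ⁻ (λ ()) h)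

dual-⊆-dual : ∀ a b s t → dual a b ⊆ dual (a + s) (b + t)
dual-⊆-dual a b s t = ++⁺ (replicate-⊆ (suc b)) (replicate-⊆ a)
  where
  replicate-⊆ : ∀ {x : Bool} i {j} → replicate i x ⊆ replicate (i + j) x
  replicate-⊆ zero    = minimum _
  replicate-⊆ (suc i) = refl ∷ replicate-⊆ i

-- Excluded words with an occurrence are exactly the `dual (a + s) (b + t)`. Keeping the surplus
-- `s`, `t` and replacing `a`, `b` by `c`, `d` is injective, and it preserves length because the
-- sums agree.
#-excluded-occurs-≤ : ∀ a b c d → a + b ≡ c + d → ∀ m →
  # (excluded-occurs? a b) (words m) ≤ # (excluded-occurs? c d) (words m)
#-excluded-occurs-≤ a b c d eq m = matching⇒length-≤ Shifted (Unique.filter⁺ _ (words-unique m)) shift-to injective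
  where
  Shifted : List Bool → List Bool → Set
  Shifted w w′ = ∃₂ λ s t → w ≡ dual (a + s) (b + t) × w′ ≡ dual (c + s) (d + t)

  shifted-sum : ∀ s t → (a + s) + (b + t) ≡ (c + s) + (d + t)
  shifted-sum s t = trans (interchange a s b t) (trans (cong (_+ (s + t)) eq) (interchange c d s t))

  shift-to : ∀ {w} → w ∈ filter (excluded-occurs? a b) (words m) →
    ∃[ w′ ] w′ ∈ filter (excluded-occurs? c d) (words m) × Shifted w w′
  shift-to i
    with j , (p , q , refl) , occ ← ∈-filter⁻ (excluded-occurs? a b) {xs = words m} i
    with a≤p , b≤q ← Occurs-dual⇒≤ a b p q occ
    with s , refl ← m≤n⇒∃[o]m+o≡n a≤p | t , refl ← m≤n⇒∃[o]m+o≡n b≤q =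
    dual (c + s) (d + t) ,
    ∈-filter⁺ (excluded-occurs? c d)
      (subst (λ k → dual (c + s) (d + t) ∈ words k)
        (trans (length-dual (c + s) (d + t)) (trans (cong suc (sym (shifted-sum s t)))
          (trans (sym (length-dual (a + s) (b + t))) (∈words⁻ m j))))
        (∈words⁺ _))
      ((c + s , d + t , refl) , inj₂ (dual-⊆-dual c d s t)) ,
    s , t , refl , refl

  injective : ∀ {w w′ u} → Shifted w u → Shifted w′ u → w ≡ w′
  injective (s , t , refl , e) (s′ , t′ , refl , e′)
    with p , q ← dual-injective {c + s} {d + t} {c + s′} {d + t′} (trans (sym e) e′) =
    cong₂ (λ s t → dual (a + s) (b + t)) (+-cancelˡ-≡ c s s′ p) (+-cancelˡ-≡ d t t′ q)

#-reduced-split : ∀ a b m → # (¬? ∘ excluded?) (words m) ≡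
  # (λ w → ¬? (excluded? w) ×-dec occurs? a b w) (words m) + # (reduced-avoiding? a b) (words m)
#-reduced-split a b m = #-splitˡ (¬? ∘ excluded?) (occurs? a b) (words m)

-- Equally many avoiders among the non-excluded words means equally many non-excluded words with an
-- occurrence. Adding the excluded ones, which agree because the sums do, equates the sizes of the
-- unions; inclusion-exclusion then leaves the intersections.
#-both : ∀ a b c d → a + b ≡ c + d → ∀ m →
  # (reduced-avoiding? a b) (words m) ≡ # (reduced-avoiding? c d) (words m) →
  # (both? a b) (words m) ≡ # (both? c d) (words m)
#-both a b c d eq m e = +-cancelˡ-≡ (# (occurs? a b) (words m)) _ _ (begin
  # (occurs? a b) (words m) + # (both? a b) (words m)
    ≡⟨ #-∪-∩ (word a b ⊆?_) (dual a b ⊆?_) (words m) ⟩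
  # (word a b ⊆?_) (words m) + # (dual a b ⊆?_) (words m)
    ≡⟨ cong₂ _+_ (#-subword-length m (word a b) (word c d) word-eq)
                 (#-subword-length m (dual a b) (dual c d) dual-eq) ⟩
  # (word c d ⊆?_) (words m) + # (dual c d ⊆?_) (words m)
    ≡⟨ #-∪-∩ (word c d ⊆?_) (dual c d ⊆?_) (words m) ⟨
  # (occurs? c d) (words m) + # (both? c d) (words m)
    ≡⟨ cong (_+ _) occurs-eq ⟨
  # (occurs? a b) (words m) + # (both? c d) (words m) ∎)
  where
  open ≡-Reasoning

  word-eq : length (word a b) ≡ length (word c d)
  word-eq = trans (length-word a b) (trans (cong suc eq) (sym (length-word c d)))

  dual-eq : length (dual a b) ≡ length (dual c d)
  dual-eq = trans (length-dual a b) (trans (cong suc eq) (sym (length-dual c d)))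

  occurs-eq : # (occurs? a b) (words m) ≡ # (occurs? c d) (words m)
  occurs-eq = trans (#-splitʳ excluded? (occurs? a b) (words m)) (trans (cong₂ _+_
    (≤-antisym (#-excluded-occurs-≤ a b c d eq m) (#-excluded-occurs-≤ c d a b (sym eq) m))
    (+-cancelʳ-≡ (# (reduced-avoiding? a b) (words m)) _ _
      (trans (sym (#-reduced-split a b m)) (trans (#-reduced-split c d m) (cong (_ +_) (sym e))))))
    (sym (#-splitʳ excluded? (occurs? c d) (words m))))

-- Recovering the unordered pair from the counts

Equivalent : (a b c d : ℕ) → Set
Equivalent a b c d = ∀ m → # (reduced-avoiding? a b) (words m) ≡ # (reduced-avoiding? c d) (words m)

Occurs-length : ∀ a b → Occurs a b w → suc (a + b) ≤ length w
Occurs-length {w} a b (inj₁ h) = subst (_≤ length w) (length-word a b) (length-mono-≤ h)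
Occurs-length {w} a b (inj₂ h) = subst (_≤ length w) (length-dual a b) (length-mono-≤ h)

-- The non-excluded word `word a b` contains itself, so some word of its length `a + b + 1` contains
-- one of the two subwords for `c`, `d`, both of length `c + d + 1`.
equivalent⇒sum-≥ : ∀ a b c d → Equivalent a b c d → c + d ≤ a + b
equivalent⇒sum-≥ a b c d e = bound (#-transfer
    (λ w → ¬? (excluded? w) ×-dec occurs? a b w) (λ w → ¬? (excluded? w) ×-dec occurs? c d w)
    (+-cancelʳ-≡ (# (reduced-avoiding? a b) (words m)) _ _
      (trans (sym (#-reduced-split a b m)) (trans (#-reduced-split c d m)
        (cong (# (λ w → ¬? (excluded? w) ×-dec occurs? c d w) (words m) +_) (sym (e m))))))
    (subst (λ k → word a b ∈ words k) (length-word a b) (∈words⁺ (word a b)))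
    ((λ ()) , inj₁ ⊆-refl))
  where
  m = suc (a + b)

  bound : ∃[ w ] w ∈ words m × ¬ Excluded w × Occurs c d w → c + d ≤ a + b
  bound (w , i , _ , occ) = s≤s⁻¹ (subst (suc (c + d) ≤_) (∈words⁻ m i) (Occurs-length c d occ))

-- For use with `k` equal to `a` and to `b`: the common superword transfers to `c`, `d` at the same
-- length, and `Both-length` bounds that length from below.
equivalent⇒min-≤ : ∀ a b c d {k} → Equivalent a b c d → a + b ≡ c + d →
  CommonSuperword a b (suc (suc (a + b)) + k) → c ≤ k ⊎ d ≤ k
equivalent⇒min-≤ a b c d {k} e eq (_ , i , both) =
  bound (#-transfer (both? a b) (both? c d) (#-both a b c d eq m (e m)) i both)
  where
  m = suc (suc (a + b)) + k

  cancel : ∀ {l} → suc (suc (c + d)) + l ≤ suc (suc (a + b)) + k → l ≤ k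
  cancel {l} h = +-cancelˡ-≤ (suc (suc (c + d))) l k (subst (λ n → suc (suc (c + d)) + l ≤ suc (suc n) + k) eq h)

  bound : CommonSuperword c d m → c ≤ k ⊎ d ≤ k
  bound (w , i , both) = Sum.map (cancel {c}) (cancel {d})
    (subst (λ n → suc (suc (c + d)) + c ≤ n ⊎ suc (suc (c + d)) + d ≤ n) (∈words⁻ m i) (Both-length c d both))

complement-≤ : ∀ {a b c d} → a + b ≡ c + d → c ≤ a → b ≤ d
complement-≤ {a} {b} {c} {d} eq c≤a =
  +-cancelˡ-≤ c b d (≤-trans (+-monoˡ-≤ b c≤a) (≤-reflexive eq))

-- The four alternatives together say min a b = min c d. If `c` and `d` lie below different members
-- of the pair `a`, `b`, the equal sums force equality; otherwise one of them lies below both `a`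
-- and `b`, and a bound in the other direction makes it equal to one of these.
pair-determined : ∀ a b c d → a + b ≡ c + d →
  c ≤ a ⊎ d ≤ a → c ≤ b ⊎ d ≤ b → a ≤ c ⊎ b ≤ c → a ≤ d ⊎ b ≤ d →
  (a ≡ c × b ≡ d) ⊎ (a ≡ d × b ≡ c)
pair-determined a b c d eq p q r t = go p q r t
  where
  eq′ : a + b ≡ d + c
  eq′ = trans eq (+-comm c d)

  from-a≡c : a ≡ c → (a ≡ c × b ≡ d) ⊎ (a ≡ d × b ≡ c)
  from-a≡c refl = inj₁ (refl , +-cancelˡ-≡ a b d eq)

  from-a≡d : a ≡ d → (a ≡ c × b ≡ d) ⊎ (a ≡ d × b ≡ c)
  from-a≡d refl = inj₂ (refl , +-cancelˡ-≡ a b c eq′)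

  from-b≡d : b ≡ d → (a ≡ c × b ≡ d) ⊎ (a ≡ d × b ≡ c)
  from-b≡d refl = inj₁ (+-cancelʳ-≡ b a c eq , refl)

  from-b≡c : b ≡ c → (a ≡ c × b ≡ d) ⊎ (a ≡ d × b ≡ c)
  from-b≡c refl = inj₂ (+-cancelʳ-≡ b a d eq′ , refl)

  go : c ≤ a ⊎ d ≤ a → c ≤ b ⊎ d ≤ b → a ≤ c ⊎ b ≤ c → a ≤ d ⊎ b ≤ d →
    (a ≡ c × b ≡ d) ⊎ (a ≡ d × b ≡ c)
  go (inj₁ c≤a) (inj₂ d≤b) _ _ = from-b≡d (≤-antisym (complement-≤ eq c≤a) d≤b)
  go (inj₁ c≤a) (inj₁ c≤b) (inj₁ a≤c) _ = from-a≡c (≤-antisym a≤c c≤a)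
  go (inj₁ c≤a) (inj₁ c≤b) (inj₂ b≤c) _ = from-b≡c (≤-antisym b≤c c≤b)
  go (inj₂ d≤a) (inj₁ c≤b) _ _ = from-b≡c (≤-antisym (complement-≤ eq′ d≤a) c≤b)
  go (inj₂ d≤a) (inj₂ d≤b) _ (inj₁ a≤d) = from-a≡d (≤-antisym a≤d d≤a)
  go (inj₂ d≤a) (inj₂ d≤b) _ (inj₂ b≤d) = from-b≡d (≤-antisym b≤d d≤b)

theorem3p18 : (a b c d : ℕ) →
    ¬ ((a ≡ c × b ≡ d) ⊎ (a ≡ d × b ≡ c)) →
    ¬ WilfEquivalent (p1342 ∷ sigma (word a b) ∷ []) (p1342 ∷ sigma (word c d) ∷ [])
theorem3p18 a b c d distinct wilf = distinct (pair-determined a b c d sums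
  (equivalent⇒min-≤ a b c d equiv sums (common-superwordˡ a b))
  (equivalent⇒min-≤ a b c d equiv sums (common-superwordʳ a b))
  (equivalent⇒min-≤ c d a b (sym ∘ equiv) (sym sums) (common-superwordˡ c d))
  (equivalent⇒min-≤ c d a b (sym ∘ equiv) (sym sums) (common-superwordʳ c d)))
  where
  equiv : Equivalent a b c d
  equiv m = trans (sym (avCount≡count-words a b m))
    (trans (wilf (suc m) (s≤s z≤n)) (avCount≡count-words c d m))

  sums : a + b ≡ c + d
  sums = ≤-antisym (equivalent⇒sum-≥ c d a b (sym ∘ equiv)) (equivalent⇒sum-≥ a b c d equiv)
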